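{- Let $\Delta=\Delta(p)$ be a function of the prime $p$ with $\Delta(p)\to\infty$ as $p\to\infty$, and let $N$ and $S$ be any integers. Then the set $$\{xy^{ -1}\pmod p:\ N+1\le x\le N+\Delta\, p^{1/2},\ S+1\le y\le S+\Delta\, p^{1/2},\ p\nmid y\}$$ (with $x,y$ integers) contains $(1+O(\Delta^{ -2}))\,p$ residue classes modulo $p$.
   Context: $y^{ -1}$ denotes the multiplicative inverse of $y$ modulo $p$. The statement is asymptotic as the prime $p\to\infty$ (i.e. for all sufficiently large $p$), and the constant implied by $O$ is uniform in $p$, $N$ and $S$ ($N$ and $S$ may depend on $p$). -}

module Defs where

open import Data.Fin.Base using (Fin; zero; suc; toℕ)
open import Data.Fin.Subset using (Subset; inside; outside) renaming (_∈_ to _∈ˢ_; ∣_∣ to ∣_∣ˢ)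
open import Data.Integer.Base as ℤ using (ℤ; +_)
import Data.Integer.Divisibility as ℤ
import Data.Integer.Properties as ℤ
open import Data.Nat.Base as ℕ using (ℕ; zero; suc)
import Data.Nat.Properties as ℕ
import Data.Nat.Tactic.RingSolver as ℕ
open import Data.Nat.Primality using (Prime)
open import Data.Product.Base using (Σ-syntax; ∃; ∃-syntax; _×_; _,_)
open import Data.Rational.Base as ℚ
  using (ℚ; mkℚ; 0ℚ; 1ℚ; ½; _+_; _*_; _-_; -_; 1/_; _/_; ∣_∣; _≤_; _<_)
import Data.Rational.Properties as ℚ
open import Data.Rational.Solver using (module +-*-Solver)
open import Data.Rational.Unnormalised.Base as ℚᵘ using (mkℚᵘ)
import Data.Rational.Unnormalised.Properties as ℚᵘ
open import Data.Sum.Base using (inj₁; inj₂)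
open import Data.Vec.Base using ([]; _∷_; here; there)
open import Function.Base using (_∘_)
open import Function.Bundles using (_⇔_; mk⇔; Equivalence)
open import Relation.Binary.PropositionalEquality
  using (_≡_; refl; sym; trans; cong; cong₂; subst; subst₂)
open import Relation.Nullary using (¬_; yes; no)
open import Relation.Nullary.Negation using (contradiction)
open import Relation.Unary using (Pred)
open import Level using (0ℓ)

⊔≤⇒≤ˡ : ∀ a b {c} → a ℕ.⊔ b ℕ.≤ c → a ℕ.≤ c
⊔≤⇒≤ˡ a b = ℕ.≤-trans (ℕ.m≤m⊔n a b)

⊔≤⇒≤ʳ : ∀ a b {c} → a ℕ.⊔ b ℕ.≤ c → b ℕ.≤ c
⊔≤⇒≤ʳ a b = ℕ.≤-trans (ℕ.m≤n⊔m a b)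

0<½* : ∀ {ε} → 0ℚ < ε → 0ℚ < ½ * ε
0<½* {ε} 0<ε = subst (_< ½ * ε) (ℚ.*-zeroʳ ½) (ℚ.*-monoʳ-<-pos ½ 0<ε)

½+½ : ∀ ε → ½ * ε + ½ * ε ≡ ε
½+½ ε = trans (sym (ℚ.*-distribʳ-+ ε ½ ½)) (ℚ.*-identityˡ ε)

0<* : ∀ {a b} → 0ℚ < a → 0ℚ < b → 0ℚ < a * b
0<* {a} {b} 0<a 0<b =
  subst (_< a * b) (ℚ.*-zeroʳ a) (ℚ.*-monoʳ-<-pos a {{ℚ.positive 0<a}} 0<b)

0≤* : ∀ {a b} → 0ℚ ≤ a → 0ℚ ≤ b → 0ℚ ≤ a * b
0≤* {a} {b} 0≤a 0≤b =
  subst (_≤ a * b) (ℚ.*-zeroʳ a) (ℚ.*-monoˡ-≤-nonNeg a {{ℚ.nonNegative 0≤a}} 0≤b)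

*-mono-≤ : ∀ {a b c d} → 0ℚ ≤ a → 0ℚ ≤ d → a ≤ b → c ≤ d → a * c ≤ b * d
*-mono-≤ {a} {b} {c} {d} 0≤a 0≤d a≤b c≤d = ℚ.≤-trans
  (ℚ.*-monoˡ-≤-nonNeg a {{ℚ.nonNegative 0≤a}} c≤d)
  (ℚ.*-monoʳ-≤-nonNeg d {{ℚ.nonNegative 0≤d}} a≤b)

∣∣-comm : ∀ a b → ∣ a - b ∣ ≡ ∣ b - a ∣
∣∣-comm a b = trans (cong ∣_∣ (solve 2 (λ x y → x :- y := :- (y :- x)) refl a b)) (ℚ.∣-p∣≡∣p∣ (b - a))
  where open +-*-Solver

∣∣-≤ : ∀ {a c} → a ≤ c → - a ≤ c → ∣ a ∣ ≤ c
∣∣-≤ {a} {c} a≤c -a≤c with ℚ.∣p∣≡p∨∣p∣≡-p a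
... | inj₁ eq = subst (_≤ c) (sym eq) a≤c
... | inj₂ eq = subst (_≤ c) (sym eq) -a≤c

∣∣∣-∣∣∣≤ : ∀ a b → ∣ ∣ a ∣ - ∣ b ∣ ∣ ≤ ∣ a - b ∣
∣∣∣-∣∣∣≤ a b = ∣∣-≤ (half a b) (subst₂ _≤_ (flip ∣ a ∣ ∣ b ∣) (∣∣-comm b a) (half b a))
  where
  open +-*-Solver
  flip : ∀ u v → v - u ≡ - (u - v)
  flip = solve 2 (λ u v → v :- u := :- (u :- v)) refl
  half : ∀ u v → ∣ u ∣ - ∣ v ∣ ≤ ∣ u - v ∣
  half u v = subst (∣ u ∣ - ∣ v ∣ ≤_)
    (solve 2 (λ x y → x :+ y :- y := x) refl ∣ u - v ∣ ∣ v ∣)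
    (ℚ.+-monoˡ-≤ (- ∣ v ∣)
      (subst (λ t → ∣ t ∣ ≤ ∣ u - v ∣ + ∣ v ∣)
        (solve 2 (λ x y → (x :- y) :+ y := x) refl u v)
        (ℚ.∣p+q∣≤∣p∣+∣q∣ (u - v) v)))

∣*∣-close : ∀ a b c d {B B′ η η′} → 0ℚ ≤ η → 0ℚ ≤ η′ →
  ∣ a ∣ ≤ B → ∣ d ∣ ≤ B′ → ∣ c - d ∣ ≤ η → ∣ a - b ∣ ≤ η′ →
  ∣ a * c - b * d ∣ ≤ B * η + B′ * η′
∣*∣-close a b c d {B} {B′} {η} {η′} 0≤η 0≤η′ hB hB′ hη hη′ = begin
  ∣ a * c - b * d ∣                      ≡⟨ cong ∣_∣ (split a b c d) ⟩
  ∣ a * (c - d) + d * (a - b) ∣          ≤⟨ ℚ.∣p+q∣≤∣p∣+∣q∣ (a * (c - d)) (d * (a - b)) ⟩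
  ∣ a * (c - d) ∣ + ∣ d * (a - b) ∣      ≡⟨ cong₂ _+_ (ℚ.∣p*q∣≡∣p∣*∣q∣ a (c - d)) (ℚ.∣p*q∣≡∣p∣*∣q∣ d (a - b)) ⟩
  ∣ a ∣ * ∣ c - d ∣ + ∣ d ∣ * ∣ a - b ∣  ≤⟨ ℚ.+-mono-≤ (*-mono-≤ (ℚ.0≤∣p∣ a) 0≤η hB hη) (*-mono-≤ (ℚ.0≤∣p∣ d) 0≤η′ hB′ hη′) ⟩
  B * η + B′ * η′                        ∎
  where
  open ℚ.≤-Reasoning
  open +-*-Solver
  split : ∀ a b c d → a * c - b * d ≡ a * (c - d) + d * (a - b)
  split = solve 4 (λ a b c d → a :* c :- b :* d := a :* (c :- d) :+ d :* (a :- b)) refl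

-- Totalised by an arbitrary value at 0; a positive real has only finitely
-- many zero terms, so up to _≃ℝ_ `inverse` below does not depend on that value.
recip : ℚ → ℚ
recip q with q ℚ.≟ 0ℚ
... | yes _  = 0ℚ
... | no q≢0 = 1/_ q {{ℚ.≢-nonZero q≢0}}

recip-inverseˡ : ∀ {q} → 0ℚ < q → recip q * q ≡ 1ℚ
recip-inverseˡ {q} 0<q with q ℚ.≟ 0ℚ
... | yes q≡0 = contradiction (sym q≡0) (ℚ.<⇒≢ 0<q)
... | no q≢0  = ℚ.*-inverseˡ q {{ℚ.≢-nonZero q≢0}}

0<recip : ∀ {q} → 0ℚ < q → 0ℚ < recip q
0<recip {q} 0<q with q ℚ.≟ 0ℚ
... | yes q≡0 = contradiction (sym q≡0) (ℚ.<⇒≢ 0<q)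
... | no q≢0  = ℚ.positive⁻¹ _ {{ℚ.1/pos⇒pos q {{ℚ.positive 0<q}}}}

0≤recip : ∀ {q} → 0ℚ < q → 0ℚ ≤ recip q
0≤recip = ℚ.<⇒≤ ∘ 0<recip

Eventually : Pred (ℕ → Set) 0ℓ
Eventually P = ∃[ M ] ∀ n → M ℕ.≤ n → P n

Cauchy : Pred (ℕ → ℚ) 0ℓ
Cauchy x = ∀ ε → 0ℚ < ε → ∃[ M ] ∀ m n → M ℕ.≤ m → M ℕ.≤ n → ∣ x m - x n ∣ ≤ ε

-- Cauchy sequences of rationals, identified up to _≃ℝ_ below.
record ℝ : Set where
  constructor mkℝ
  field
    seq    : ℕ → ℚ
    cauchy : Cauchy seq

open ℝ public

infix  4 _≤ℝ_ _<ℝ_ _≃ℝ_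
infixl 6 _+ℝ_
infixl 7 _*ℝ_

_≤ℝ_ : ℝ → ℝ → Set
x ≤ℝ y = ∀ ε → 0ℚ < ε → Eventually λ n → seq x n ≤ seq y n + ε

_<ℝ_ : ℝ → ℝ → Set
x <ℝ y = ∃[ δ ] 0ℚ < δ × Eventually λ n → seq x n + δ ≤ seq y n

_≃ℝ_ : ℝ → ℝ → Set
x ≃ℝ y = ∀ ε → 0ℚ < ε → Eventually λ n → ∣ seq x n - seq y n ∣ ≤ ε

fromℚ : ℚ → ℝ
fromℚ q = mkℝ (λ _ → q) λ ε 0<ε →
  0 , λ _ _ _ _ → subst (λ t → ∣ t ∣ ≤ ε) (sym (ℚ.+-inverseʳ q)) (ℚ.<⇒≤ 0<ε)

fromℤ : ℤ → ℝ
fromℤ i = fromℚ (i / 1)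

fromℕ : ℕ → ℝ
fromℕ n = fromℤ (+ n)

0ℝ 1ℝ : ℝ
0ℝ = fromℚ 0ℚ
1ℝ = fromℚ 1ℚ

_+ℝ_ : ℝ → ℝ → ℝ
x +ℝ y = mkℝ (λ n → seq x n + seq y n) cau
  where
  open +-*-Solver
  cau : Cauchy (λ n → seq x n + seq y n)
  cau ε 0<ε with cauchy x (½ * ε) (0<½* 0<ε) | cauchy y (½ * ε) (0<½* 0<ε)
  ... | M , hx | M′ , hy = M ℕ.⊔ M′ , λ m n M≤m M≤n →
    let a = seq x m; b = seq x n; c = seq y m; d = seq y n in
    subst₂ _≤_
      refl (½+½ ε)
      (ℚ.≤-trans
        (subst (λ t → ∣ t ∣ ≤ ∣ a - b ∣ + ∣ c - d ∣)
          (solve 4 (λ a b c d → (a :- b) :+ (c :- d) := (a :+ c) :- (b :+ d)) refl a b c d)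
          (ℚ.∣p+q∣≤∣p∣+∣q∣ (a - b) (c - d)))
        (ℚ.+-mono-≤
          (hx m n (⊔≤⇒≤ˡ M M′ M≤m) (⊔≤⇒≤ˡ M M′ M≤n))
          (hy m n (⊔≤⇒≤ʳ M M′ M≤m) (⊔≤⇒≤ʳ M M′ M≤n))))

∣_∣ℝ : ℝ → ℝ
∣ x ∣ℝ = mkℝ (λ n → ∣ seq x n ∣) λ ε 0<ε →
  let M , h = cauchy x ε 0<ε in
  M , λ m n M≤m M≤n → ℚ.≤-trans (∣∣∣-∣∣∣≤ (seq x m) (seq x n)) (h m n M≤m M≤n)

eventually-bounded : ∀ x → ∃[ B ] 0ℚ < B × Eventually λ n → ∣ seq x n ∣ ≤ B
eventually-bounded x with cauchy x 1ℚ (ℚ.positive⁻¹ 1ℚ)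
... | M , h = 1ℚ + ∣ seq x M ∣ , 0<B , M , λ n M≤n →
    subst (λ t → ∣ t ∣ ≤ 1ℚ + ∣ seq x M ∣)
      (solve 2 (λ a b → (a :- b) :+ b := a) refl (seq x n) (seq x M))
      (ℚ.≤-trans (ℚ.∣p+q∣≤∣p∣+∣q∣ (seq x n - seq x M) (seq x M))
        (ℚ.+-monoˡ-≤ ∣ seq x M ∣ (h n M M≤n ℕ.≤-refl)))
  where
  open +-*-Solver
  0<B : 0ℚ < 1ℚ + ∣ seq x M ∣
  0<B = ℚ.+-mono-<-≤ {0ℚ} {1ℚ} (ℚ.positive⁻¹ 1ℚ) (ℚ.0≤∣p∣ (seq x M))

_*ℝ_ : ℝ → ℝ → ℝ
x *ℝ y = mkℝ (λ n → seq x n * seq y n) cau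
  where
  open +-*-Solver
  scale : ∀ {B ε} → 0ℚ < B → 0ℚ < ε → ∃[ η ] 0ℚ < η × B * η ≡ ½ * ε
  scale {B} {ε} 0<B 0<ε = recip B * (½ * ε) , 0<* (0<recip 0<B) (0<½* 0<ε) ,
    trans (solve 3 (λ b r e → b :* (r :* e) := (r :* b) :* e) refl B (recip B) (½ * ε))
      (trans (cong (_* (½ * ε)) (recip-inverseˡ 0<B)) (ℚ.*-identityˡ (½ * ε)))
  cau : Cauchy (λ n → seq x n * seq y n)
  cau ε 0<ε =
    let B , 0<B , M₁ , hB = eventually-bounded x
        B′ , 0<B′ , M₂ , hB′ = eventually-bounded y
        η , 0<η , Bη = scale 0<B 0<ε
        η′ , 0<η′ , B′η′ = scale 0<B′ 0<ε
        M₃ , hy = cauchy y η 0<η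
        M₄ , hx = cauchy x η′ 0<η′
    in combine Bη B′η′ (ℚ.<⇒≤ 0<η) (ℚ.<⇒≤ 0<η′) M₁ M₂ M₃ M₄ hB hB′ hy hx
    where
    combine : ∀ {B B′ η η′} → B * η ≡ ½ * ε → B′ * η′ ≡ ½ * ε → 0ℚ ≤ η → 0ℚ ≤ η′ →
      ∀ M₁ M₂ M₃ M₄ →
      (∀ n → M₁ ℕ.≤ n → ∣ seq x n ∣ ≤ B) →
      (∀ n → M₂ ℕ.≤ n → ∣ seq y n ∣ ≤ B′) →
      (∀ m n → M₃ ℕ.≤ m → M₃ ℕ.≤ n → ∣ seq y m - seq y n ∣ ≤ η) →
      (∀ m n → M₄ ℕ.≤ m → M₄ ℕ.≤ n → ∣ seq x m - seq x n ∣ ≤ η′) →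
      ∃[ M ] ∀ m n → M ℕ.≤ m → M ℕ.≤ n → ∣ seq x m * seq y m - seq x n * seq y n ∣ ≤ ε
    combine Bη B′η′ 0≤η 0≤η′ M₁ M₂ M₃ M₄ hB hB′ hy hx = (M₁ ℕ.⊔ M₂) ℕ.⊔ (M₃ ℕ.⊔ M₄) , λ m n M≤m M≤n →
      let M₁₂≤m = ⊔≤⇒≤ˡ (M₁ ℕ.⊔ M₂) (M₃ ℕ.⊔ M₄) M≤m
          M₁₂≤n = ⊔≤⇒≤ˡ (M₁ ℕ.⊔ M₂) (M₃ ℕ.⊔ M₄) M≤n
          M₃₄≤m = ⊔≤⇒≤ʳ (M₁ ℕ.⊔ M₂) (M₃ ℕ.⊔ M₄) M≤m
          M₃₄≤n = ⊔≤⇒≤ʳ (M₁ ℕ.⊔ M₂) (M₃ ℕ.⊔ M₄) M≤n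
      in subst (∣ seq x m * seq y m - seq x n * seq y n ∣ ≤_) (trans (cong₂ _+_ Bη B′η′) (½+½ ε))
        (∣*∣-close (seq x m) (seq x n) (seq y m) (seq y n) 0≤η 0≤η′
          (hB m (⊔≤⇒≤ˡ M₁ M₂ M₁₂≤m)) (hB′ n (⊔≤⇒≤ʳ M₁ M₂ M₁₂≤n))
          (hy m n (⊔≤⇒≤ˡ M₃ M₄ M₃₄≤m) (⊔≤⇒≤ˡ M₃ M₄ M₃₄≤n))
          (hx m n (⊔≤⇒≤ʳ M₃ M₄ M₃₄≤m) (⊔≤⇒≤ʳ M₃ M₄ M₃₄≤n)))

inverse : (x : ℝ) → 0ℝ <ℝ x → ℝ
inverse x (δ , 0<δ , M , hδ) = mkℝ (recip ∘ seq x) cau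
  where
  open +-*-Solver
  cau : Cauchy (recip ∘ seq x)
  cau ε 0<ε with cauchy x (ε * (δ * δ)) (0<* 0<ε (0<* 0<δ 0<δ))
  ... | M′ , hx = M ℕ.⊔ M′ , λ m n M≤m M≤n →
      let a = seq x m; b = seq x n; u = recip a; v = recip b
          δ≤a = δ≤ m (⊔≤⇒≤ˡ M M′ M≤m)
          δ≤b = δ≤ n (⊔≤⇒≤ˡ M M′ M≤n)
          0<a = ℚ.<-≤-trans 0<δ δ≤a
          0<b = ℚ.<-≤-trans 0<δ δ≤b
          0≤u = 0≤recip 0<a
          0≤v = 0≤recip 0<b
          0≤uv = 0≤* 0≤u 0≤v
          uδ≤1 : u * δ ≤ 1ℚ
          uδ≤1 = subst (u * δ ≤_) (recip-inverseˡ 0<a)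
                   (ℚ.*-monoˡ-≤-nonNeg u {{ℚ.nonNegative 0≤u}} δ≤a)
          vδ≤1 : v * δ ≤ 1ℚ
          vδ≤1 = subst (v * δ ≤_) (recip-inverseˡ 0<b)
                   (ℚ.*-monoˡ-≤-nonNeg v {{ℚ.nonNegative 0≤v}} δ≤b)
          diff : (u * v) * (b - a) ≡ u - v
          diff = trans
            (solve 4 (λ u v a b → (u :* v) :* (b :- a) := u :* (v :* b) :- v :* (u :* a)) refl u v a b)
            (trans (cong₂ (λ s t → u * s - v * t) (recip-inverseˡ 0<b) (recip-inverseˡ 0<a))
              (cong₂ _-_ (ℚ.*-identityʳ u) (ℚ.*-identityʳ v)))
      in begin
        ∣ u - v ∣                    ≡⟨ cong ∣_∣ diff ⟨
        ∣ (u * v) * (b - a) ∣        ≡⟨ ℚ.∣p*q∣≡∣p∣*∣q∣ (u * v) (b - a) ⟩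
        ∣ u * v ∣ * ∣ b - a ∣        ≡⟨ cong₂ _*_ (ℚ.0≤p⇒∣p∣≡p 0≤uv) (∣∣-comm b a) ⟩
        (u * v) * ∣ a - b ∣          ≤⟨ ℚ.*-monoˡ-≤-nonNeg (u * v) {{ℚ.nonNegative 0≤uv}}
                                          (hx m n (⊔≤⇒≤ʳ M M′ M≤m) (⊔≤⇒≤ʳ M M′ M≤n)) ⟩
        (u * v) * (ε * (δ * δ))      ≡⟨ solve 4 (λ u v ε δ → (u :* v) :* (ε :* (δ :* δ))
                                          := ε :* ((u :* δ) :* (v :* δ))) refl u v ε δ ⟩
        ε * ((u * δ) * (v * δ))      ≤⟨ ℚ.*-monoˡ-≤-nonNeg ε {{ℚ.nonNegative (ℚ.<⇒≤ 0<ε)}}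
                                          (*-mono-≤ (0≤* 0≤u (ℚ.<⇒≤ 0<δ)) (ℚ.<⇒≤ (ℚ.positive⁻¹ 1ℚ)) uδ≤1 vδ≤1) ⟩
        ε * (1ℚ * 1ℚ)                ≡⟨ ℚ.*-identityʳ ε ⟩
        ε                            ∎
    where
    open ℚ.≤-Reasoning
    δ≤ : ∀ n → M ℕ.≤ n → δ ≤ seq x n
    δ≤ n M≤n = subst (_≤ seq x n) (ℚ.+-identityˡ δ) (hδ n M≤n)

-- ⌊ √n ⌋
isqrt : ℕ → ℕ
isqrt zero = 0
isqrt (suc n) with suc (isqrt n) ℕ.* suc (isqrt n) ℕ.≤? suc n
... | yes _ = suc (isqrt n)
... | no  _ = isqrt n

isqrt-≤ : ∀ n → isqrt n ℕ.* isqrt n ℕ.≤ n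
isqrt-≤ zero = ℕ.z≤n
isqrt-≤ (suc n) with suc (isqrt n) ℕ.* suc (isqrt n) ℕ.≤? suc n
... | yes p = p
... | no  _ = ℕ.m≤n⇒m≤1+n (isqrt-≤ n)

isqrt-< : ∀ n → n ℕ.< suc (isqrt n) ℕ.* suc (isqrt n)
isqrt-< zero = ℕ.s≤s ℕ.z≤n
isqrt-< (suc n) with suc (isqrt n) ℕ.* suc (isqrt n) ℕ.≤? suc n
... | yes _ = ℕ.≤-<-trans (isqrt-< n)
  (ℕ.*-mono-< (ℕ.n<1+n (suc (isqrt n))) (ℕ.n<1+n (suc (isqrt n))))
... | no ¬p = ℕ.≰⇒> ¬p

-- The k-th term is ⌊ (k + 1) √n ⌋ / (k + 1).
√-seq : ℕ → ℕ → ℚ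
√-seq n k = + isqrt (n ℕ.* (suc k ℕ.* suc k)) / suc k

√-seq-close : ∀ n j k → √-seq n j ≤ √-seq n k + + 1 / suc k
√-seq-close n j k = ℚ.toℚᵘ-cancel-≤ (begin
    ℚ.toℚᵘ (√-seq n j)                        ≃⟨ ℚ.toℚᵘ-fromℚᵘ (mkℚᵘ (+ s) j) ⟩
    mkℚᵘ (+ s) j                              ≤⟨ ℚᵘ.*≤* (subst₂ ℤ._≤_ lhs rhs (ℤ.+≤+ main)) ⟩
    mkℚᵘ (+ t) k ℚᵘ.+ mkℚᵘ (+ 1) k            ≃⟨ ℚᵘ.+-cong (ℚ.toℚᵘ-fromℚᵘ (mkℚᵘ (+ t) k))
                                                           (ℚ.toℚᵘ-fromℚᵘ (mkℚᵘ (+ 1) k)) ⟨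
    ℚ.toℚᵘ (√-seq n k) ℚᵘ.+ ℚ.toℚᵘ (+ 1 / suc k)
                                              ≃⟨ ℚ.toℚᵘ-homo-+ (√-seq n k) (+ 1 / suc k) ⟨
    ℚ.toℚᵘ (√-seq n k + + 1 / suc k)          ∎)
  where
  open ℚᵘ.≤-Reasoning
  J = suc j
  K = suc k
  s = isqrt (n ℕ.* (J ℕ.* J))
  t = isqrt (n ℕ.* (K ℕ.* K))

  square-cancel : ∀ a b → a ℕ.* a ℕ.≤ b ℕ.* b → a ℕ.≤ b
  square-cancel a b a²≤b² with a ℕ.≤? b
  ... | yes a≤b = a≤b
  ... | no  a≰b = contradiction (ℕ.*-mono-< (ℕ.≰⇒> a≰b) (ℕ.≰⇒> a≰b)) (ℕ.≤⇒≯ a²≤b²)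

  sK≤tJ : s ℕ.* K ℕ.≤ suc t ℕ.* J
  sK≤tJ = square-cancel (s ℕ.* K) (suc t ℕ.* J)
    (subst₂ ℕ._≤_ (sym (square s K)) (sym (square (suc t) J))
      (ℕ.≤-trans (ℕ.*-monoˡ-≤ (K ℕ.* K) (isqrt-≤ (n ℕ.* (J ℕ.* J))))
        (subst (ℕ._≤ suc t ℕ.* suc t ℕ.* (J ℕ.* J)) (swap n (K ℕ.* K) (J ℕ.* J))
          (ℕ.*-monoˡ-≤ (J ℕ.* J) (ℕ.<⇒≤ (isqrt-< (n ℕ.* (K ℕ.* K))))))))
    where
    square : ∀ a b → (a ℕ.* b) ℕ.* (a ℕ.* b) ≡ a ℕ.* a ℕ.* (b ℕ.* b)
    square = ℕ.solve-∀
    swap : ∀ a b c → a ℕ.* b ℕ.* c ≡ a ℕ.* c ℕ.* b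
    swap = ℕ.solve-∀

  main : s ℕ.* (K ℕ.* K) ℕ.≤ (t ℕ.* K ℕ.+ 1 ℕ.* K) ℕ.* J
  main = subst₂ ℕ._≤_ (ℕ.*-assoc s K K) (rearrange t J K) (ℕ.*-monoˡ-≤ K sK≤tJ)
    where
    rearrange : ∀ t J K → suc t ℕ.* J ℕ.* K ≡ (t ℕ.* K ℕ.+ 1 ℕ.* K) ℕ.* J
    rearrange = ℕ.solve-∀

  lhs : + (s ℕ.* (K ℕ.* K)) ≡ + s ℤ.* + (K ℕ.* K)
  lhs = ℤ.pos-* s (K ℕ.* K)

  rhs : + ((t ℕ.* K ℕ.+ 1 ℕ.* K) ℕ.* J) ≡ (+ t ℤ.* + K ℤ.+ + 1 ℤ.* + K) ℤ.* + J
  rhs = trans (ℤ.pos-* (t ℕ.* K ℕ.+ 1 ℕ.* K) J)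
    (cong (ℤ._* + J) (trans (ℤ.pos-+ (t ℕ.* K) (1 ℕ.* K))
      (cong₂ ℤ._+_ (ℤ.pos-* t K) (ℤ.pos-* 1 K))))

archimedean : ∀ ε → 0ℚ < ε → Eventually λ k → + 1 / suc k ≤ ε
archimedean ε@(mkℚ (+ suc a) d _) _ = d , λ k d≤k → ℚ.toℚᵘ-cancel-≤ (begin
    ℚ.toℚᵘ (+ 1 / suc k)   ≃⟨ ℚ.toℚᵘ-fromℚᵘ (mkℚᵘ (+ 1) k) ⟩
    mkℚᵘ (+ 1) k           ≤⟨ ℚᵘ.*≤* (ℤ.+≤+ (ℕ.*-mono-≤ (ℕ.s≤s (ℕ.z≤n {a})) (ℕ.s≤s d≤k))) ⟩
    mkℚᵘ (+ suc a) d       ∎)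
  where open ℚᵘ.≤-Reasoning
archimedean (mkℚ (+ 0) _ _) (ℚ.*<* (ℤ.+<+ ()))
archimedean (mkℚ ℤ.-[1+ _ ] _ _) (ℚ.*<* ())

√_ : ℕ → ℝ
√ n = mkℝ (√-seq n) cau
  where
  open +-*-Solver
  cau : Cauchy (√-seq n)
  cau ε 0<ε with archimedean ε 0<ε
  ... | M , h = M , λ j k M≤j M≤k → ∣∣-≤
      (close j k M≤k)
      (subst (_≤ ε)
        (solve 2 (λ x y → y :- x := :- (x :- y)) refl (√-seq n j) (√-seq n k))
        (close k j M≤j))
    where
    close : ∀ j k → M ℕ.≤ k → √-seq n j - √-seq n k ≤ ε
    close j k M≤k = subst (√-seq n j - √-seq n k ≤_)
      (solve 2 (λ x e → x :+ e :- x := e) refl (√-seq n k) ε)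
      (ℚ.+-monoˡ-≤ (- √-seq n k)
        (ℚ.≤-trans (√-seq-close n j k) (ℚ.+-monoʳ-≤ (√-seq n k) (h k M≤k))))

infix 8 √_

HasCardinality : ∀ {n} → Pred (Fin n) 0ℓ → ℕ → Set
HasCardinality {n} P c = Σ[ T ∈ Subset n ] (∀ i → (i ∈ˢ T) ⇔ P i) × ∣ T ∣ˢ ≡ c

-- HasCardinality is not vacuous: classically every subset has a cardinality.
¬¬-HasCardinality : ∀ {n} (P : Pred (Fin n) 0ℓ) → ¬ ¬ ∃ (HasCardinality P)
¬¬-HasCardinality {zero} P k = k (0 , [] , (λ ()) , refl)
¬¬-HasCardinality {suc n} P k = ¬¬-HasCardinality (P ∘ suc) λ (_ , T , h , _) →
  let ¬P0 : ¬ P zero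
      ¬P0 p = k (_ , inside ∷ T ,
        (λ { zero    → mk⇔ (λ _ → p) (λ _ → here)
           ; (suc i) → mk⇔ (λ { (there q) → Equivalence.to (h i) q })
                           (λ q → there (Equivalence.from (h i) q)) }) , refl)
  in k (_ , outside ∷ T ,
        (λ { zero    → mk⇔ (λ ()) (λ p → contradiction p ¬P0)
           ; (suc i) → mk⇔ (λ { (there q) → Equivalence.to (h i) q })
                           (λ q → there (Equivalence.from (h i) q)) }) , refl)

infix 4 _≡_[mod_]

_≡_[mod_] : ℤ → ℤ → ℕ → Set
a ≡ b [mod p ] = + p ℤ.∣ (a ℤ.- b)

-- Residue classes are represented by Fin p; z is an inverse of y modulo p,
-- and the residue of x * z does not depend on which inverse is taken.
Quotients : (p : ℕ) (N S : ℤ) (H : ℝ) → Pred (Fin p) 0ℓ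
Quotients p N S H r =
  ∃[ x ] ∃[ y ]
    ((N ℤ.+ + 1 ℤ.≤ x) × (fromℤ x ≤ℝ fromℤ N +ℝ H)) ×
    ((S ℤ.+ + 1 ℤ.≤ y) × (fromℤ y ≤ℝ fromℤ S +ℝ H)) ×
    ¬ (+ p ℤ.∣ y) ×
    ∃[ z ] (y ℤ.* z ≡ + 1 [mod p ]) × (+ toℕ r ≡ x ℤ.* z [mod p ])

TendsToInfinityOnPrimes : (ℕ → ℝ) → Set
TendsToInfinityOnPrimes Δ =
  ∀ (K : ℝ) → ∃[ P ] ∀ p → Prime p → P ℕ.≤ p → K ≤ℝ Δ p

{-# OPTIONS --safe #-}

-- Fix r and consider the lattice of all (x , y) with x ≡ r y (mod p); its
-- determinant is p.  Running the subtractive Euclidean algorithm from the basis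
-- (r , 1), (r - p , 1) until both first coordinates are at most K either passes
-- a vector with both coordinates below A ≈ p / K, or ends in a basis whose
-- entries are O(K).  In the latter case every box of side a constant times K
-- contains a lattice point, so r is represented once K is a small multiple of
-- Δ √p.  In the former case r ≡ ± a / b with a, b < A, which holds for at most
-- 2 A² = O(p / Δ²) residues r.
module Submission where

open import Defs
open import Data.Integer.Base using (ℤ)
open import Data.Nat.Base using (ℕ; _≤_)
open import Data.Nat.Primality using (Prime)
open import Data.Product.Base using (∃-syntax; Σ-syntax; _×_)

open import Data.Fin.Base using (Fin; zero; suc; toℕ; fromℕ<; combine; punchOut)
import Data.Fin.Properties as Fin
open import Data.Fin.Subset using (Subset; inside; outside; ∁) renaming (_∈_ to _∈ˢ_; ∣_∣ to ∣_∣ˢ)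
import Data.Fin.Subset.Properties as Subset
open import Data.Integer.Base as ℤ using (+_; -[1+_])
open import Data.Integer.Divisibility.Signed as Signed using (_∣_)
import Data.Integer.DivMod as ℤ
import Data.Integer.Properties as ℤ
import Data.Integer.Tactic.RingSolver as ℤ
open import Data.Nat.Base as ℕ using (zero; suc; z≤n; s≤s)
import Data.Nat.Coprimality as ℕ
import Data.Nat.Divisibility as ℕ
import Data.Nat.DivMod as ℕ
import Data.Nat.GCD as ℕ
open import Data.Nat.Primality
  using (prime⇒nonZero; prime⇒nonTrivial; prime⇒irreducible; euclidsLemma)
import Data.Nat.Properties as ℕ
import Data.Nat.Tactic.RingSolver as ℕ
open import Data.Product.Base using (_,_; proj₁; proj₂)
open import Data.Rational.Base as ℚ using (ℚ; mkℚ; 0ℚ; 1ℚ)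
import Data.Rational.Properties as ℚ
open import Data.Rational.Solver using (module +-*-Solver)
open import Data.Rational.Unnormalised.Base as ℚᵘ using (mkℚᵘ)
import Data.Rational.Unnormalised.Properties as ℚᵘ
open import Data.Sum.Base using (_⊎_; inj₁; inj₂)
open import Data.Vec.Base using ([]; _∷_; here; there)
open import Function.Base using (_∘_)
open import Function.Bundles using (Equivalence)
open import Relation.Binary.Definitions using (tri<; tri≈; tri>)
open import Relation.Binary.PropositionalEquality
  using (_≡_; refl; sym; trans; cong; cong₂; subst; subst₂; module ≡-Reasoning)
open import Relation.Nullary using (Dec; ¬_; yes; no; contradiction)

-- The signs make the reduction work. With basis vectors (a₁ , b₁) and (- a₂ , b₂) and natural
-- entries, the determinant p is a sum of two non-negative products, a₁ b₂ + a₂ b₁, so a lower bound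
-- on one first coordinate is an upper bound on the opposite second coordinate. Since p < A K, a₁ >
-- K forces b₂ < A, and a₂ ≥ A forces b₁ < K. One more step therefore produces a second coordinate
-- below A + K, which A ≤ K turns into 2 K. But p < A K and A ≤ K together require K² > p, and this
-- is where Δ has to be large. The condition p ∤ y is a separate obstacle: the lattice point found
-- in a box may have p ∣ y. A second box repairs this only while the two boxes together are shorter
-- than p; intervals with at least p integers are handled directly. The real length Δ √p is met only
-- through its rational approximations. It is replaced by a natural number h such that, from some
-- index on, every approximation lies between h and h + 3.

-- Lattice reduction and lattice points in boxes.

module Lattice (p : ℕ) where
  open import Data.Integer.Base using (_+_; _*_; _-_)

  -- The congruence r ≡ ± a / b with the denominator cleared; the two signs are kept apart so that a
  -- and b can be natural numbers.
  SmallFraction : ℕ → ℤ → Set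
  SmallFraction A r = ∃[ a ] ∃[ b ] a ℕ.< A × 0 ℕ.< b × b ℕ.< A ×
    ((+ p ∣ + a - r * + b) ⊎ (+ p ∣ + a + r * + b))

  -- The basis vectors are u = (a₁ , b₁) and v = (- a₂ , b₂).
  record Basis (r : ℤ) (a₁ b₁ a₂ b₂ : ℕ) : Set where
    field
      det : a₁ ℕ.* b₂ ℕ.+ a₂ ℕ.* b₁ ≡ p
      u∈  : + p ∣ + a₁ - r * + b₁
      v∈  : + p ∣ + a₂ + r * + b₂

  open Basis

  -- The reflection (x , y) ↦ (- x , y) carries the lattice of r to that of - r and exchanges the
  -- roles of the two basis vectors. It lets the reduction assume a₂ ≤ a₁.
  flip : ∀ {r a₁ b₁ a₂ b₂} → Basis r a₁ b₁ a₂ b₂ → Basis (ℤ.- r) a₂ b₂ a₁ b₁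
  flip {r} {a₁} {b₁} {a₂} {b₂} B = record
    { det = trans (ℕ.+-comm (a₂ ℕ.* b₁) (a₁ ℕ.* b₂)) (B .det)
    ; u∈  = subst (+ p ∣_) (v-neg (+ a₂) r (+ b₂)) (B .v∈)
    ; v∈  = subst (+ p ∣_) (u-neg (+ a₁) r (+ b₁)) (B .u∈)
    }
    where
    v-neg : ∀ a r b → a + r * b ≡ a - (ℤ.- r) * b
    v-neg = ℤ.solve-∀
    u-neg : ∀ a r b → a - r * b ≡ a + (ℤ.- r) * b
    u-neg = ℤ.solve-∀

  -- One Euclidean step, u replaced by u + v: the first coordinates cancel and the second ones add
  -- up. Membership is obtained by a subtraction because `v∈` is stated for - v.
  addˡ : ∀ {r d b₁ a₂ b₂} → Basis r (a₂ ℕ.+ d) b₁ a₂ b₂ → Basis r d (b₁ ℕ.+ b₂) a₂ b₂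
  addˡ {r} {d} {b₁} {a₂} {b₂} B = record
    { det = trans (rearrange d b₁ a₂ b₂) (B .det)
    ; u∈  = subst (+ p ∣_)
        (trans (cong (λ t → (t - r * + b₁) - (+ a₂ + r * + b₂)) (ℤ.pos-+ a₂ d))
          (trans (subtract (+ d) (+ b₁) (+ a₂) (+ b₂) r)
            (cong (λ t → + d - r * t) (sym (ℤ.pos-+ b₁ b₂)))))
        (Signed.∣m∣n⇒∣m-n (B .u∈) (B .v∈))
    ; v∈  = B .v∈
    }
    where
    rearrange : ∀ d b₁ a₂ b₂ → d ℕ.* b₂ ℕ.+ a₂ ℕ.* (b₁ ℕ.+ b₂) ≡ (a₂ ℕ.+ d) ℕ.* b₂ ℕ.+ a₂ ℕ.* b₁
    rearrange = ℕ.solve-∀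
    subtract : ∀ d b₁ a₂ b₂ r → (a₂ + d - r * b₁) - (a₂ + r * b₂) ≡ d - r * (b₁ + b₂)
    subtract = ℤ.solve-∀

  module Reduction {K A : ℕ} (p<AK : p ℕ.< A ℕ.* K) (A≤K : A ℕ.≤ K) where

    record Reduced (r : ℤ) : Set where
      field
        {a₁ b₁ a₂ b₂} : ℕ
        basis : Basis r a₁ b₁ a₂ b₂
        a₁≤K : a₁ ℕ.≤ K
        a₂≤K : a₂ ℕ.≤ K
        b₁≤2K : b₁ ℕ.≤ K ℕ.+ K
        b₂≤2K : b₂ ℕ.≤ K ℕ.+ K

    Outcome : ℤ → Set
    Outcome r = SmallFraction A r ⊎ Reduced r

    flip-outcome : ∀ {r} → Outcome (ℤ.- r) → Outcome r
    flip-outcome {r} (inj₁ (a , b , a<A , 0<b , b<A , h)) =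
      inj₁ (a , b , a<A , 0<b , b<A , negate h)
      where
      minus : ∀ a r b → a - (ℤ.- r) * b ≡ a + r * b
      minus = ℤ.solve-∀
      plus : ∀ a r b → a + (ℤ.- r) * b ≡ a - r * b
      plus = ℤ.solve-∀
      negate : (+ p ∣ + a - (ℤ.- r) * + b) ⊎ (+ p ∣ + a + (ℤ.- r) * + b) →
        (+ p ∣ + a - r * + b) ⊎ (+ p ∣ + a + r * + b)
      negate (inj₁ d) = inj₂ (subst (+ p ∣_) (minus (+ a) r (+ b)) d)
      negate (inj₂ d) = inj₁ (subst (+ p ∣_) (plus (+ a) r (+ b)) d)
    flip-outcome {r} (inj₂ R) = inj₂ (record
      { basis = subst (λ t → Basis t a₂ b₂ a₁ b₁) (ℤ.neg-involutive r) (flip basis)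
      ; a₁≤K = a₂≤K ; a₂≤K = a₁≤K ; b₁≤2K = b₂≤2K ; b₂≤2K = b₁≤2K })
      where open Reduced R

    0<K : 0 ℕ.< K
    0<K = ℕ.n≢0⇒n>0 λ K≡0 → ℕ.n≮0 (subst (p ℕ.<_) (trans (cong (A ℕ.*_) K≡0) (ℕ.*-zeroʳ A)) p<AK)

    0<A : 0 ℕ.< A
    0<A = ℕ.n≢0⇒n>0 λ A≡0 → ℕ.n≮0 (subst (p ℕ.<_) (cong (ℕ._* K) A≡0) p<AK)

    -- The recursion is on a bound `n` for a₁ + a₂, from which each Euclidean step removes a₂ ≥ A >
    -- 0.
    step : ∀ n {r a₁ b₁ a₂ b₂} → a₂ ℕ.≤ a₁ → a₁ ℕ.+ a₂ ℕ.≤ n → 0 ℕ.< b₁ → 0 ℕ.< b₂ →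
      b₁ ℕ.≤ K ℕ.+ K → b₂ ℕ.≤ K ℕ.+ K → Basis r a₁ b₁ a₂ b₂ → Outcome r
    reduce : ∀ n {r a₁ b₁ a₂ b₂} → a₁ ℕ.+ a₂ ℕ.≤ n → 0 ℕ.< b₁ → 0 ℕ.< b₂ →
      b₁ ℕ.≤ K ℕ.+ K → b₂ ℕ.≤ K ℕ.+ K → Basis r a₁ b₁ a₂ b₂ → Outcome r

    step n {r} {a₁} {b₁} {a₂} {b₂} a₂≤a₁ a≤n 0<b₁ 0<b₂ b₁≤ b₂≤ B with a₁ ℕ.≤? K | a₂ ℕ.<? A
    ... | yes a₁≤K | _ = inj₂ (record
      { basis = B ; a₁≤K = a₁≤K ; a₂≤K = ℕ.≤-trans a₂≤a₁ a₁≤K ; b₁≤2K = b₁≤ ; b₂≤2K = b₂≤ })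
    ... | no a₁≰K | a₂<A? = next n a₂<A? a≤n
      where
      open ℕ.≤-Reasoning
      K<a₁ = ℕ.≰⇒> a₁≰K

      b₂<A : b₂ ℕ.< A
      b₂<A = ℕ.*-cancelʳ-< _ b₂ A (begin-strict
        b₂ ℕ.* K                   ≤⟨ ℕ.*-monoʳ-≤ b₂ (ℕ.<⇒≤ K<a₁) ⟩
        b₂ ℕ.* a₁                  ≡⟨ ℕ.*-comm b₂ a₁ ⟩
        a₁ ℕ.* b₂                  ≤⟨ ℕ.m≤m+n _ _ ⟩
        a₁ ℕ.* b₂ ℕ.+ a₂ ℕ.* b₁    ≡⟨ B .det ⟩
        p                          <⟨ p<AK ⟩
        A ℕ.* K                    ∎)

      b₁<K : A ℕ.≤ a₂ → b₁ ℕ.< K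
      b₁<K A≤a₂ = ℕ.*-cancelˡ-< A b₁ K (begin-strict
        A ℕ.* b₁                   ≤⟨ ℕ.*-monoˡ-≤ b₁ A≤a₂ ⟩
        a₂ ℕ.* b₁                  ≤⟨ ℕ.m≤n+m _ _ ⟩
        a₁ ℕ.* b₂ ℕ.+ a₂ ℕ.* b₁    ≡⟨ B .det ⟩
        p                          <⟨ p<AK ⟩
        A ℕ.* K                    ∎)

      next : ∀ n → Dec (a₂ ℕ.< A) → a₁ ℕ.+ a₂ ℕ.≤ n → Outcome r
      -- Both coordinates of v are now below A, so r ≡ - a₂ / b₂.
      next _ (yes a₂<A) _ = inj₁ (a₂ , b₂ , a₂<A , 0<b₂ , b₂<A , inj₂ (B .v∈))
      next zero (no _) a≤0 = contradiction (ℕ.≤-trans (ℕ.≤-trans (s≤s z≤n) K<a₁) (ℕ.m+n≤o⇒m≤o a₁ a≤0)) ℕ.n≮0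
      next (suc n) (no a₂≮A) a≤n = reduce n
        (ℕ.s≤s⁻¹ (begin
          suc (a₁ ℕ.∸ a₂ ℕ.+ a₂)   ≡⟨ cong suc (ℕ.m∸n+n≡m a₂≤a₁) ⟩
          suc a₁                   ≡⟨ ℕ.+-comm 1 a₁ ⟩
          a₁ ℕ.+ 1                 ≤⟨ ℕ.+-monoʳ-≤ a₁ (ℕ.<-≤-trans 0<A A≤a₂) ⟩
          a₁ ℕ.+ a₂                ≤⟨ a≤n ⟩
          suc n                    ∎))
        (ℕ.≤-trans 0<b₁ (ℕ.m≤m+n b₁ b₂)) 0<b₂
        -- The new second coordinate b₁ + b₂ is bounded afresh by K + A ≤ 2 K from the determinant,
        -- so the bound does not grow with the number of steps.
        (ℕ.+-mono-≤ (ℕ.<⇒≤ (b₁<K A≤a₂)) (ℕ.≤-trans (ℕ.<⇒≤ b₂<A) A≤K)) b₂≤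
        (addˡ (subst (λ a → Basis r a b₁ a₂ b₂) (sym (ℕ.m+[n∸m]≡n a₂≤a₁)) B))
        where A≤a₂ = ℕ.≮⇒≥ a₂≮A

    reduce n {r} {a₁} {b₁} {a₂} {b₂} a≤n 0<b₁ 0<b₂ b₁≤ b₂≤ B with ℕ.≤-total a₂ a₁
    ... | inj₁ a₂≤a₁ = step n a₂≤a₁ a≤n 0<b₁ 0<b₂ b₁≤ b₂≤ B
    ... | inj₂ a₁≤a₂ = flip-outcome
      (step n a₁≤a₂ (subst (ℕ._≤ n) (ℕ.+-comm a₁ a₂) a≤n) 0<b₂ 0<b₁ b₂≤ b₁≤ (flip B))

    reduced : ∀ {r} → r ℕ.≤ p → Outcome (+ r)
    reduced {r} r≤p = reduce p (ℕ.≤-reflexive r+[p∸r]≡p) (s≤s z≤n) (s≤s z≤n) 1≤2K 1≤2K (record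
      { det = trans (cong₂ ℕ._+_ (ℕ.*-identityʳ r) (ℕ.*-identityʳ (p ℕ.∸ r))) r+[p∸r]≡p
      ; u∈  = Signed.divides (+ 0) (cancels (+ r))
      ; v∈  = Signed.divides (+ 1) (begin
          + (p ℕ.∸ r) + + r * + 1   ≡⟨ completes (+ (p ℕ.∸ r)) (+ r) ⟩
          + r + + (p ℕ.∸ r)         ≡⟨ ℤ.pos-+ r (p ℕ.∸ r) ⟨
          + (r ℕ.+ (p ℕ.∸ r))       ≡⟨ cong +_ r+[p∸r]≡p ⟩
          + p                       ≡⟨ ℤ.*-identityˡ (+ p) ⟨
          + 1 * + p                 ∎)
      })
      where
      open ≡-Reasoning
      r+[p∸r]≡p = ℕ.m+[n∸m]≡n r≤p
      1≤2K = ℕ.≤-trans 0<K (ℕ.m≤m+n K K)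
      cancels : ∀ r → r - r * + 1 ≡ + 0
      cancels = ℤ.solve-∀
      completes : ∀ s r → s + r * + 1 ≡ r + s
      completes = ℤ.solve-∀

    -- The window for x is two-sided because the first coordinates of the basis vectors have
    -- opposite signs, and the one for y is one-sided because both second coordinates are
    -- non-negative; 4 K is the sum of two second coordinates of size at most 2 K.
    PointNear : (r X Y : ℤ) → Set
    PointNear r X Y = ∃[ x ] ∃[ y ] (+ p ∣ x - r * y) ×
      (X ℤ.≤ x + + K) × (x ℤ.≤ X + + K) × (Y ℤ.≤ y + + (4 ℕ.* K)) × (y ℤ.≤ Y)

    -- The translates of the half-open fundamental parallelogram of a basis
    -- tile the plane: round the coordinates of (X , Y) in the basis down.
    lattice-point : .{{_ : ℕ.NonZero p}} → ∀ {r} → Reduced r → ∀ X Y →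
      PointNear r X Y
    lattice-point {r} R X Y = x , y , x≡ry , X≤ , ≤X , Y≤ , ≤Y
      where
      open Reduced R
      n₁ n₂ s t x y : ℤ
      -- Cramer's rule: n₁ / p and n₂ / p are the coordinates of (X , Y) in the basis. The
      -- remainders e₁ and e₂ below are p times the fractional parts.
      n₁ = X * + b₂ + Y * + a₂
      n₂ = Y * + a₁ - X * + b₁
      s = n₁ ℤ./ℕ p
      t = n₂ ℤ./ℕ p
      x = s * + a₁ - t * + a₂
      y = s * + b₁ + t * + b₂
      e₁ e₂ : ℕ
      e₁ = n₁ ℤ.%ℕ p
      e₂ = n₂ ℤ.%ℕ p
      e₁≤p = ℕ.<⇒≤ (ℤ.n%ℕd<d n₁ p)
      e₂≤p = ℕ.<⇒≤ (ℤ.n%ℕd<d n₂ p)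

      x≡ry : + p ∣ x - r * y
      x≡ry = subst (+ p ∣_) (regroup s t r (+ a₁) (+ b₁) (+ a₂) (+ b₂))
        (Signed.∣m∣n⇒∣m-n (Signed.∣n⇒∣m*n s (basis .u∈)) (Signed.∣n⇒∣m*n t (basis .v∈)))
        where
        regroup : ∀ s t r a₁ b₁ a₂ b₂ →
          s * (a₁ - r * b₁) - t * (a₂ + r * b₂) ≡ (s * a₁ - t * a₂) - r * (s * b₁ + t * b₂)
        regroup = ℤ.solve-∀

      det′ : + a₁ * + b₂ + + a₂ * + b₁ ≡ + p
      det′ = trans (sym (trans (ℤ.pos-+ (a₁ ℕ.* b₂) (a₂ ℕ.* b₁)) (cong₂ _+_ (ℤ.pos-* a₁ b₂) (ℤ.pos-* a₂ b₁))))
        (cong +_ (basis .det))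

      -- This is p (X - x) = e₁ a₁ - e₂ a₂ with each product moved to the side where it is
      -- non-negative; dropping one of them gives each half of the window.
      px : + p * X + + (e₂ ℕ.* a₂) ≡ + p * x + + (e₁ ℕ.* a₁)
      px = begin
        + p * X + + (e₂ ℕ.* a₂)
          ≡⟨ cong₂ (λ d e → d * X + e) (sym det′) (ℤ.pos-* e₂ a₂) ⟩
        (+ a₁ * + b₂ + + a₂ * + b₁) * X + + e₂ * + a₂
          ≡⟨ expand X Y (+ a₁) (+ b₁) (+ a₂) (+ b₂) (+ e₂) ⟩
        n₁ * + a₁ - (n₂ - + e₂) * + a₂
          ≡⟨ cong₂ (λ m n → m * + a₁ - (n - + e₂) * + a₂) (ℤ.a≡a%ℕn+[a/ℕn]*n n₁ p) (ℤ.a≡a%ℕn+[a/ℕn]*n n₂ p) ⟩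
        (+ e₁ + s * + p) * + a₁ - (+ e₂ + t * + p - + e₂) * + a₂
          ≡⟨ collect (+ e₁) (+ e₂) s t (+ p) (+ a₁) (+ a₂) ⟩
        + p * x + + e₁ * + a₁
          ≡⟨ cong (λ u → + p * x + u) (ℤ.pos-* e₁ a₁) ⟨
        + p * x + + (e₁ ℕ.* a₁) ∎
        where
        open ≡-Reasoning
        expand : ∀ X Y a₁ b₁ a₂ b₂ e₂ → (a₁ * b₂ + a₂ * b₁) * X + e₂ * a₂ ≡
          (X * b₂ + Y * a₂) * a₁ - (Y * a₁ - X * b₁ - e₂) * a₂
        expand = ℤ.solve-∀
        collect : ∀ e₁ e₂ s t p a₁ a₂ → (e₁ + s * p) * a₁ - (e₂ + t * p - e₂) * a₂ ≡
          p * (s * a₁ - t * a₂) + e₁ * a₁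
        collect = ℤ.solve-∀

      py : + p * Y ≡ + p * y + + (e₁ ℕ.* b₁ ℕ.+ e₂ ℕ.* b₂)
      py = begin
        + p * Y
          ≡⟨ cong (_* Y) (sym det′) ⟩
        (+ a₁ * + b₂ + + a₂ * + b₁) * Y
          ≡⟨ expand X Y (+ a₁) (+ b₁) (+ a₂) (+ b₂) ⟩
        n₁ * + b₁ + n₂ * + b₂
          ≡⟨ cong₂ (λ m n → m * + b₁ + n * + b₂) (ℤ.a≡a%ℕn+[a/ℕn]*n n₁ p) (ℤ.a≡a%ℕn+[a/ℕn]*n n₂ p) ⟩
        (+ e₁ + s * + p) * + b₁ + (+ e₂ + t * + p) * + b₂
          ≡⟨ collect (+ e₁) (+ e₂) s t (+ p) (+ b₁) (+ b₂) ⟩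
        + p * y + (+ e₁ * + b₁ + + e₂ * + b₂)
          ≡⟨ cong (λ u → + p * y + u) (trans (ℤ.pos-+ (e₁ ℕ.* b₁) (e₂ ℕ.* b₂)) (cong₂ _+_ (ℤ.pos-* e₁ b₁) (ℤ.pos-* e₂ b₂))) ⟨
        + p * y + + (e₁ ℕ.* b₁ ℕ.+ e₂ ℕ.* b₂) ∎
        where
        open ≡-Reasoning
        expand : ∀ X Y a₁ b₁ a₂ b₂ → (a₁ * b₂ + a₂ * b₁) * Y ≡
          (X * b₂ + Y * a₂) * b₁ + (Y * a₁ - X * b₁) * b₂
        expand = ℤ.solve-∀
        collect : ∀ e₁ e₂ s t p b₁ b₂ → (e₁ + s * p) * b₁ + (e₂ + t * p) * b₂ ≡
          p * (s * b₁ + t * b₂) + (e₁ * b₁ + e₂ * b₂)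
        collect = ℤ.solve-∀

      divide : ∀ {i j k m} → + p * i ℤ.≤ + p * j + + k → k ℕ.≤ p ℕ.* m → i ℤ.≤ j + + m
      divide {i} {j} {k} {m} h k≤ = ℤ.*-cancelˡ-≤-pos i (j + + m) (+ p) {{ℤ.positive (ℤ.+<+ (ℕ.>-nonZero⁻¹ p))}} (begin
        + p * i                ≤⟨ h ⟩
        + p * j + + k          ≤⟨ ℤ.+-monoʳ-≤ (+ p * j) (ℤ.+≤+ k≤) ⟩
        + p * j + + (p ℕ.* m)  ≡⟨ cong (λ u → + p * j + u) (ℤ.pos-* p m) ⟩
        + p * j + + p * + m    ≡⟨ ℤ.*-distribˡ-+ (+ p) j (+ m) ⟨
        + p * (j + + m)        ∎)
        where open ℤ.≤-Reasoning

      X≤ : X ℤ.≤ x + + K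
      X≤ = divide (ℤ.≤-trans (ℤ.i≤i+j (+ p * X) (+ (e₂ ℕ.* a₂))) (ℤ.≤-reflexive px)) (ℕ.*-mono-≤ e₁≤p a₁≤K)

      ≤X : x ℤ.≤ X + + K
      ≤X = divide (ℤ.≤-trans (ℤ.i≤i+j (+ p * x) (+ (e₁ ℕ.* a₁))) (ℤ.≤-reflexive (sym px))) (ℕ.*-mono-≤ e₂≤p a₂≤K)

      Y≤ : Y ℤ.≤ y + + (4 ℕ.* K)
      Y≤ = divide (ℤ.≤-reflexive py)
        (subst (e₁ ℕ.* b₁ ℕ.+ e₂ ℕ.* b₂ ℕ.≤_) (total p K) (ℕ.+-mono-≤ (ℕ.*-mono-≤ e₁≤p b₁≤2K) (ℕ.*-mono-≤ e₂≤p b₂≤2K)))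
        where
        total : ∀ p K → p ℕ.* (K ℕ.+ K) ℕ.+ p ℕ.* (K ℕ.+ K) ≡ p ℕ.* (4 ℕ.* K)
        total = ℕ.solve-∀

      ≤Y : y ℤ.≤ Y
      ≤Y = subst (y ℤ.≤_) (ℤ.+-identityʳ Y)
        (divide {m = 0} (ℤ.≤-trans (ℤ.i≤i+j (+ p * y) (+ (e₁ ℕ.* b₁ ℕ.+ e₂ ℕ.* b₂)))
          (ℤ.≤-reflexive (trans (sym py) (sym (ℤ.+-identityʳ (+ p * Y)))))) z≤n)

-- Pigeonhole for a map defined on `U` alone: the image of the first element is punched out of the
-- codomain before the induction continues.
injection⇒∣∣≤ : ∀ {n m} (U : Subset n) (f : ∀ i → i ∈ˢ U → Fin m) →
  (∀ {i j} (i∈U : i ∈ˢ U) (j∈U : j ∈ˢ U) → f i i∈U ≡ f j j∈U → i ≡ j) → ∣ U ∣ˢ ≤ m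
injection⇒∣∣≤ []            f inj = z≤n
injection⇒∣∣≤ (outside ∷ U) f inj = injection⇒∣∣≤ U (λ i → f (suc i) ∘ there)
  λ i∈U j∈U eq → Fin.suc-injective (inj (there i∈U) (there j∈U) eq)
injection⇒∣∣≤ {m = zero} (inside ∷ U) f inj = contradiction (f zero here) λ ()
injection⇒∣∣≤ {m = suc m} (inside ∷ U) f inj = s≤s (injection⇒∣∣≤ U
  (λ i i∈U → punchOut (0≢ i∈U))
  λ i∈U j∈U eq → Fin.suc-injective (inj (there i∈U) (there j∈U)
    (Fin.punchOut-injective (0≢ i∈U) (0≢ j∈U) eq)))
  where
  0≢ : ∀ {i} (i∈U : i ∈ˢ U) → ¬ f zero here ≡ f (suc i) (there i∈U)
  0≢ i∈U eq with () ← inj here (there i∈U) eq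

+-cancelʳ-≤ : ∀ k {i j} → i ℤ.+ k ℤ.≤ j ℤ.+ k → i ℤ.≤ j
+-cancelʳ-≤ k {i} {j} i+k≤j+k = subst₂ ℤ._≤_ (cancel i k) (cancel j k) (ℤ.+-monoˡ-≤ (ℤ.- k) i+k≤j+k)
  where
  cancel : ∀ i k → i ℤ.+ k ℤ.- k ≡ i
  cancel = ℤ.solve-∀

-- Representing residues modulo p and counting small fractions.

module Residues {p : ℕ} (p-prime : Prime p) where
  open import Data.Integer.Base using (_+_; _*_; _-_)
  open Lattice p

  instance
    p≢0 : ℕ.NonZero p
    p≢0 = prime⇒nonZero p-prime

  1<p : 1 ℕ.< p
  1<p = ℕ.nonTrivial⇒n>1 p {{prime⇒nonTrivial p-prime}}

  p∤small : ∀ {n} → 0 ℕ.< n → n ℕ.< p → ¬ (+ p ∣ + n)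
  p∤small 0<n n<p p∣n = ℕ.<⇒≱ n<p (ℕ.∣⇒≤ {{ℕ.>-nonZero 0<n}} (Signed.∣⇒∣ᵤ p∣n))

  euclid : ∀ i j → + p ∣ i * j → + p ∣ i ⊎ + p ∣ j
  euclid i j p∣ij with euclidsLemma ℤ.∣ i ∣ ℤ.∣ j ∣ p-prime (subst (p ℕ.∣_) (ℤ.abs-* i j) (Signed.∣⇒∣ᵤ p∣ij))
  ... | inj₁ p∣i = inj₁ (Signed.∣ᵤ⇒∣ p∣i)
  ... | inj₂ p∣j = inj₂ (Signed.∣ᵤ⇒∣ p∣j)

  invertible-ℕ : ∀ {n} → ¬ p ℕ.∣ n → ∃[ z ] + p ∣ + n * z - + 1
  invertible-ℕ {n} p∤n with ℕ.coprime-Bézout coprime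
    where
    coprime : ℕ.Coprime p n
    coprime (d∣p , d∣n) with prime⇒irreducible p-prime d∣p
    ... | inj₁ d≡1 = d≡1
    ... | inj₂ refl = contradiction d∣n p∤n
  ... | ℕ.Bézout.+- x y eq = ℤ.- + y , Signed.divides (ℤ.- + x) (begin
    + n * (ℤ.- + y) - + 1         ≡⟨ swap (+ n) (+ y) ⟩
    ℤ.- (+ 1 + + y * + n)         ≡⟨ cong ℤ.-_ (trans (cong (λ t → + 1 + t) (sym (ℤ.pos-* y n))) (sym (ℤ.pos-+ 1 (y ℕ.* n)))) ⟩
    ℤ.- + (1 ℕ.+ y ℕ.* n)         ≡⟨ cong (λ t → ℤ.- + t) eq ⟩
    ℤ.- + (x ℕ.* p)               ≡⟨ cong ℤ.-_ (ℤ.pos-* x p) ⟩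
    ℤ.- (+ x * + p)               ≡⟨ ℤ.neg-distribˡ-* (+ x) (+ p) ⟩
    (ℤ.- + x) * + p               ∎)
    where
    open ≡-Reasoning
    swap : ∀ n y → n * (ℤ.- y) - + 1 ≡ ℤ.- (+ 1 + y * n)
    swap = ℤ.solve-∀
  ... | ℕ.Bézout.-+ x y eq = + y , Signed.divides (+ x) (begin
    + n * + y - + 1               ≡⟨ cong (_- + 1) (trans (sym (ℤ.pos-* n y)) (cong +_ (trans (ℕ.*-comm n y) (sym eq)))) ⟩
    + (1 ℕ.+ x ℕ.* p) - + 1       ≡⟨ cong (_- + 1) (trans (ℤ.pos-+ 1 (x ℕ.* p)) (cong (λ t → + 1 + t) (ℤ.pos-* x p))) ⟩
    + 1 + + x * + p - + 1         ≡⟨ cancel (+ x * + p) ⟩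
    + x * + p                     ∎)
    where
    open ≡-Reasoning
    cancel : ∀ t → + 1 + t - + 1 ≡ t
    cancel = ℤ.solve-∀

  invertible : ∀ {y} → ¬ + p ∣ y → ∃[ z ] + p ∣ y * z - + 1
  invertible {+ n} p∤y = invertible-ℕ (p∤y ∘ Signed.∣ᵤ⇒∣)
  invertible {y@(-[1+ n ])} p∤y =
    let z , p∣ = invertible-ℕ {suc n} (p∤y ∘ Signed.∣ᵤ⇒∣)
    in ℤ.- z , subst (λ t → + p ∣ t - + 1) (negate (+ suc n) z) p∣
    where
    negate : ∀ n z → n * z ≡ (ℤ.- n) * (ℤ.- z)
    negate = ℤ.solve-∀

  Represented : (N S : ℤ) (h : ℕ) (r : ℤ) → Set
  Represented N S h r = ∃[ x ] ∃[ y ]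
    ((N + + 1 ℤ.≤ x) × (x ℤ.≤ N + + h)) ×
    ((S + + 1 ℤ.≤ y) × (y ℤ.≤ S + + h)) ×
    (¬ + p ∣ y) × (+ p ∣ x - r * y)

  -- Each of the two intervals contains a complete residue system, so y ≡ 1 and x ≡ r can be chosen
  -- independently.
  long-represented : ∀ {h} → p ℕ.≤ h → ∀ N S r → Represented N S h r
  long-represented {h} p≤h N S r = x , y , (lower N e , upper N e<p) , (lower S e′ , upper S e′<p) , p∤y , x≡ry
    where
    e e′ : ℕ
    e = (r - N - + 1) ℤ.%ℕ p
    e′ = (ℤ.- S) ℤ.%ℕ p
    e<p = ℤ.n%ℕd<d (r - N - + 1) p
    e′<p = ℤ.n%ℕd<d (ℤ.- S) p
    q q′ x y : ℤ
    q = (r - N - + 1) ℤ./ℕ p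
    q′ = (ℤ.- S) ℤ./ℕ p
    x = N + (+ 1 + + e)
    y = S + (+ 1 + + e′)

    lower : ∀ M e → M + + 1 ℤ.≤ M + (+ 1 + + e)
    lower M e = ℤ.+-monoʳ-≤ M (ℤ.i≤i+j (+ 1) (+ e))

    upper : ∀ M {e} → e ℕ.< p → M + (+ 1 + + e) ℤ.≤ M + + h
    upper M e<p = ℤ.+-monoʳ-≤ M (ℤ.+≤+ (ℕ.≤-trans e<p p≤h))

    y≡1 : y ≡ + 1 - q′ * + p
    y≡1 = trans (insert S (+ e′)) (trans (cong (λ t → + 1 + + e′ - t) (ℤ.a≡a%ℕn+[a/ℕn]*n (ℤ.- S) p))
      (cancel (+ e′) (q′ * + p)))
      where
      insert : ∀ S e → S + (+ 1 + e) ≡ + 1 + e - (ℤ.- S)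
      insert = ℤ.solve-∀
      cancel : ∀ e t → + 1 + e - (e + t) ≡ + 1 - t
      cancel = ℤ.solve-∀

    x≡r : x ≡ r - q * + p
    x≡r = trans (insert N (+ e) r) (trans (cong (λ t → r + + e - t) (ℤ.a≡a%ℕn+[a/ℕn]*n (r - N - + 1) p))
      (cancel r (+ e) (q * + p)))
      where
      insert : ∀ N e r → N + (+ 1 + e) ≡ r + e - (r - N - + 1)
      insert = ℤ.solve-∀
      cancel : ∀ r e t → r + e - (e + t) ≡ r - t
      cancel = ℤ.solve-∀

    p∤y : ¬ + p ∣ y
    p∤y p∣y = p∤small (s≤s z≤n) 1<p (subst (+ p ∣_)
      (trans (cong (_+ q′ * + p) y≡1) (cancel (q′ * + p)))
      (Signed.∣m∣n⇒∣m+n p∣y (Signed.∣n⇒∣m*n q′ Signed.∣-refl)))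
      where
      cancel : ∀ t → + 1 - t + t ≡ + 1
      cancel = ℤ.solve-∀

    x≡ry : + p ∣ x - r * y
    x≡ry = Signed.divides (r * q′ - q)
      (trans (cong₂ (λ x y → x - r * y) x≡r y≡1) (collect r q q′ (+ p)))
      where
      collect : ∀ r q q′ p → (r - q * p) - r * (+ 1 - q′ * p) ≡ (r * q′ - q) * p
      collect = ℤ.solve-∀

  module Box {K A : ℕ} (p<AK : p ℕ.< A ℕ.* K) (A≤K : A ℕ.≤ K) where
    open Reduction p<AK A≤K

    -- Of two lattice points in boxes stacked in the y direction, at most one
    -- has y divisible by p.
    reduced-represented : ∀ {h} → 2 ℕ.+ 8 ℕ.* K ℕ.≤ h → 2 ℕ.+ 8 ℕ.* K ℕ.≤ p →
      ∀ N S {r} → Reduced r → Represented N S h r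
    reduced-represented {h} 2+8K≤h 2+8K≤p N S {r} R =
      choose (lattice-point R X Y₁) (lattice-point R X Y₂)
      where
      -- The windows around these targets are x in [N + 1 , N + 1 + 2 K], y₁ in
      -- [S + 1 , S + 1 + 4 K] and y₂ in [S + 2 + 4 K , S + 2 + 8 K]; the last two are disjoint and
      -- adjacent.
      X = N + + (1 ℕ.+ K)
      Y₁ = S + + (1 ℕ.+ 4 ℕ.* K)
      Y₂ = S + + (2 ℕ.+ 8 ℕ.* K)

      drop : ∀ M a b {z} → M + + (a ℕ.+ b) ℤ.≤ z + + b → M + + a ℤ.≤ z
      drop M a b {z} = +-cancelʳ-≤ (+ b) ∘ subst (ℤ._≤ z + + b)
        (trans (cong (λ t → M + t) (ℤ.pos-+ a b)) (sym (ℤ.+-assoc M (+ a) (+ b))))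

      widen : ∀ M {a z} → a ℕ.≤ 2 ℕ.+ 8 ℕ.* K → z ℤ.≤ M + + a → z ℤ.≤ M + + h
      widen M a≤ z≤ = ℤ.≤-trans z≤ (ℤ.+-monoʳ-≤ M (ℤ.+≤+ (ℕ.≤-trans a≤ 2+8K≤h)))

      x-upper : ∀ {x} → x ℤ.≤ X + + K → x ℤ.≤ N + + h
      x-upper {x} x≤ = widen N (ℕ.+-mono-≤ {1} {2} (s≤s z≤n) 2K≤8K) (subst (x ℤ.≤_)
        (trans (ℤ.+-assoc N (+ (1 ℕ.+ K)) (+ K)) (cong (λ t → N + t) (sym (ℤ.pos-+ (1 ℕ.+ K) K)))) x≤)
        where
        2K≤8K : K ℕ.+ K ℕ.≤ 8 ℕ.* K
        2K≤8K = ℕ.+-monoʳ-≤ K (ℕ.m≤m+n K (6 ℕ.* K))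

      2+8K≡ : 2 ℕ.+ 8 ℕ.* K ≡ (2 ℕ.+ 4 ℕ.* K) ℕ.+ 4 ℕ.* K
      2+8K≡ = split K
        where
        split : ∀ K → 2 ℕ.+ 8 ℕ.* K ≡ (2 ℕ.+ 4 ℕ.* K) ℕ.+ 4 ℕ.* K
        split = ℕ.solve-∀

      Y₂-lower : ∀ {y} → Y₂ ℤ.≤ y + + (4 ℕ.* K) → S + + (2 ℕ.+ 4 ℕ.* K) ℤ.≤ y
      Y₂-lower {y} = drop S (2 ℕ.+ 4 ℕ.* K) (4 ℕ.* K) ∘ subst (λ t → S + + t ℤ.≤ y + + (4 ℕ.* K)) 2+8K≡

      choose : PointNear r X Y₁ → PointNear r X Y₂ → Represented N S h r
      choose (x₁ , y₁ , x₁≡ry₁ , X≤x₁ , x₁≤X , Y₁≤y₁ , y₁≤Y₁) (x₂ , y₂ , x₂≡ry₂ , X≤x₂ , x₂≤X , Y₂≤y₂ , y₂≤Y₂)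
        with + p Signed.∣? y₁ | + p Signed.∣? y₂
      ... | no p∤y₁  | _        = x₁ , y₁ , (drop N 1 K X≤x₁ , x-upper x₁≤X) ,
        (drop S 1 (4 ℕ.* K) Y₁≤y₁ , widen S (ℕ.≤-trans (ℕ.n≤1+n _) (ℕ.≤-trans (ℕ.m≤m+n _ (4 ℕ.* K)) (ℕ.≤-reflexive (sym 2+8K≡)))) y₁≤Y₁) , p∤y₁ , x₁≡ry₁
      ... | yes _    | no p∤y₂  = x₂ , y₂ , (drop N 1 K X≤x₂ , x-upper x₂≤X) ,
        (ℤ.≤-trans (ℤ.+-monoʳ-≤ S (ℤ.+≤+ (s≤s z≤n))) (Y₂-lower {y₂} Y₂≤y₂) , widen S ℕ.≤-refl y₂≤Y₂) , p∤y₂ , x₂≡ry₂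
      ... | yes p∣y₁ | yes p∣y₂ = contradiction (Signed.∣m∣n⇒∣m-n p∣y₂ p∣y₁) (p∤gap (y₂ - y₁) gap≥ gap≤)
        where
        -- Two multiples of p would have a difference between 1 and 1 + 8 K, which is below p.
        p∤gap : ∀ d → + 1 ℤ.≤ d → d ℤ.≤ + (1 ℕ.+ 8 ℕ.* K) → ¬ + p ∣ d
        p∤gap (+ n) (ℤ.+≤+ 1≤n) (ℤ.+≤+ n≤) = p∤small 1≤n (ℕ.≤-trans (s≤s n≤) 2+8K≤p)

        gap≥ : + 1 ℤ.≤ y₂ - y₁
        gap≥ = subst (ℤ._≤ y₂ - y₁) (cancel S (+ (4 ℕ.* K))) (ℤ.+-mono-≤ (Y₂-lower {y₂} Y₂≤y₂) (ℤ.neg-mono-≤ y₁≤Y₁))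
          where
          cancel : ∀ S k → S + (+ 2 + k) - (S + (+ 1 + k)) ≡ + 1
          cancel = ℤ.solve-∀

        gap≤ : y₂ - y₁ ℤ.≤ + (1 ℕ.+ 8 ℕ.* K)
        gap≤ = subst (y₂ - y₁ ℤ.≤_) (cancel S (+ (8 ℕ.* K))) (ℤ.+-mono-≤ y₂≤Y₂ (ℤ.neg-mono-≤ (drop S 1 (4 ℕ.* K) Y₁≤y₁)))
          where
          cancel : ∀ S k → S + (+ 2 + k) - (S + + 1) ≡ + 1 + k
          cancel = ℤ.solve-∀

  -- Multiply x ≡ r y by an inverse z of y. The hypothesis on `h` and `H` is the interface between
  -- the integer box and the real one.
  represented⇒quotient : ∀ {N S h H} → (∀ M x → x ℤ.≤ M + + h → fromℤ x ≤ℝ fromℤ M +ℝ H) →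
    ∀ {i} → Represented N S h (+ toℕ i) → Quotients p N S H i
  represented⇒quotient {N} {S} below {i} (x , y , (N<x , x≤) , (S<y , y≤) , p∤y , x≡ry) =
    let z , yz≡1 = invertible p∤y in
    x , y , (N<x , below N x x≤) , (S<y , below S y y≤) , p∤y ∘ Signed.∣ᵤ⇒∣ , z , Signed.∣⇒∣ᵤ yz≡1 ,
    Signed.∣⇒∣ᵤ (subst (+ p ∣_) (combined x y z (+ toℕ i))
      (Signed.∣m⇒∣-m (Signed.∣m∣n⇒∣m+n (Signed.∣n⇒∣m*n z x≡ry) (Signed.∣n⇒∣m*n (+ toℕ i) yz≡1))))
    where
    combined : ∀ x y z r → ℤ.- (z * (x - r * y) + r * (y * z - + 1)) ≡ r - x * z
    combined = ℤ.solve-∀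

  -- The triple (sign , a , b) determines r: if i and j share it, then p divides (i - j) b, and 0 <
  -- b < A ≤ p leaves only p ∣ i - j.
  small-fractions-few : ∀ {A} → A ℕ.≤ p → (U : Subset p) →
    (∀ i → i ∈ˢ U → SmallFraction A (+ toℕ i)) → ∣ U ∣ˢ ≤ 2 ℕ.* (A ℕ.* A)
  small-fractions-few {A} A≤p U small = injection⇒∣∣≤ U (λ i i∈U → code (+ toℕ i) (small i i∈U))
    λ {i} {j} i∈U j∈U → code-injective {i} {j} (small _ i∈U) (small _ j∈U)
    where
    sign : ∀ {P Q : Set} → P ⊎ Q → Fin 2
    sign (inj₁ _) = zero
    sign (inj₂ _) = suc zero

    code : ∀ r → SmallFraction A r → Fin (2 ℕ.* (A ℕ.* A))
    code _ (a , b , a<A , _ , b<A , h) = combine (sign h) (combine (fromℕ< a<A) (fromℕ< b<A))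

    difference : ∀ a b i j → (+ p ∣ a - i * b) → (+ p ∣ a - j * b) → + p ∣ (i - j) * b
    difference a b i j hi hj = subst (+ p ∣_) (cancel a b i j) (Signed.∣m∣n⇒∣m-n hj hi)
      where
      cancel : ∀ a b i j → a - j * b - (a - i * b) ≡ (i - j) * b
      cancel = ℤ.solve-∀

    difference′ : ∀ a b i j → (+ p ∣ a + i * b) → (+ p ∣ a + j * b) → + p ∣ (i - j) * b
    difference′ a b i j hi hj = subst (+ p ∣_) (cancel a b i j) (Signed.∣m∣n⇒∣m-n hi hj)
      where
      cancel : ∀ a b i j → a + i * b - (a + j * b) ≡ (i - j) * b
      cancel = ℤ.solve-∀

    gap : ∀ {m n} → n ℕ.< m → + m - + n ≡ + (m ℕ.∸ n)
    gap {m} {n} n<m = trans (ℤ.m-n≡m⊖n m n) (ℤ.⊖-≥ (ℕ.<⇒≤ n<m))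

    congruent⇒≡ : ∀ {i j : Fin p} → + p ∣ + toℕ i - + toℕ j → i ≡ j
    congruent⇒≡ {i} {j} p∣i-j with ℕ.<-cmp (toℕ i) (toℕ j)
    ... | tri≈ _ i≡j _ = Fin.toℕ-injective i≡j
    ... | tri> _ _ j<i = contradiction (subst (+ p ∣_) (gap j<i) p∣i-j)
      (p∤small (ℕ.m<n⇒0<n∸m j<i) (ℕ.≤-<-trans (ℕ.m∸n≤m (toℕ i) (toℕ j)) (Fin.toℕ<n i)))
    ... | tri< i<j _ _ = contradiction (subst (+ p ∣_) (trans (negate (+ toℕ i) (+ toℕ j)) (gap i<j)) (Signed.∣m⇒∣-m p∣i-j))
      (p∤small (ℕ.m<n⇒0<n∸m i<j) (ℕ.≤-<-trans (ℕ.m∸n≤m (toℕ j) (toℕ i)) (Fin.toℕ<n j)))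
      where
      negate : ∀ m n → ℤ.- (m - n) ≡ n - m
      negate = ℤ.solve-∀

    code-injective : ∀ {i j : Fin p} (F : SmallFraction A (+ toℕ i)) (G : SmallFraction A (+ toℕ j)) →
      code (+ toℕ i) F ≡ code (+ toℕ j) G → i ≡ j
    code-injective {i} {j} (a , b , a<A , 0<b , b<A , h) (a′ , b′ , a′<A , _ , b′<A , h′) eq
      with eq₁ , eq₂ ← Fin.combine-injective (sign h) _ (sign h′) _ eq
      with eq₃ , eq₄ ← Fin.combine-injective (fromℕ< a<A) _ (fromℕ< a′<A) _ eq₂
      with refl ← Fin.fromℕ<-injective a a′ a<A a′<A eq₃
      with refl ← Fin.fromℕ<-injective b b′ b<A b′<A eq₄
      with euclid (+ toℕ i - + toℕ j) (+ b) (same h h′ eq₁)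
      where
      same : ∀ (h : (+ p ∣ + a - + toℕ i * + b) ⊎ (+ p ∣ + a + + toℕ i * + b))
        (h′ : (+ p ∣ + a - + toℕ j * + b) ⊎ (+ p ∣ + a + + toℕ j * + b)) →
        sign h ≡ sign h′ → + p ∣ (+ toℕ i - + toℕ j) * + b
      same (inj₁ d) (inj₁ d′) _ = difference (+ a) (+ b) (+ toℕ i) (+ toℕ j) d d′
      same (inj₂ d) (inj₂ d′) _ = difference′ (+ a) (+ b) (+ toℕ i) (+ toℕ j) d d′
    ... | inj₁ p∣i-j = congruent⇒≡ p∣i-j
    ... | inj₂ p∣b = contradiction p∣b (p∤small 0<b (ℕ.<-≤-trans b<A A≤p))

square-cancel-≤ : ∀ {m n} → m ℕ.* m ≤ n ℕ.* n → m ≤ n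
square-cancel-≤ m²≤n² = ℕ.≮⇒≥ λ n<m → ℕ.<⇒≱ (ℕ.*-mono-< n<m n<m) m²≤n²

-- Counting the missing residues.

module Count {p : ℕ} (p-prime : Prime p) {h W K A : ℕ} (2+8K≤h : 2 ℕ.+ 8 ℕ.* K ≤ h) (W≤K*32 : W ≤ K ℕ.* 32)
  (p<AK : p ℕ.< A ℕ.* K) (A≤K : A ≤ K) (AK≤p+K : A ℕ.* K ≤ p ℕ.+ K) where
  open Residues p-prime
  open Lattice p
  open ℕ.≤-Reasoning

  -- If p ≤ h, nothing is missing. Otherwise 2 + 8 K ≤ h < p, which allows the two-box argument and
  -- gives K ≤ p; the missing residues are then small fractions, and A K ≤ p + K ≤ 2 p.
  missing-bound : ∀ N S (U : Subset p) → (∀ i → i ∈ˢ U → ¬ Represented N S h (+ toℕ i)) →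
    ∣ U ∣ˢ ℕ.* (W ℕ.* W) ≤ p ℕ.* p ℕ.* 8192
  missing-bound N S U missing with p ℕ.≤? h
  ... | yes p≤h = subst (λ m → m ℕ.* (W ℕ.* W) ≤ p ℕ.* p ℕ.* 8192) (sym ∣U∣≡0) z≤n
    where
    none : ∀ i → ¬ i ∈ˢ U
    none i i∈U = missing i i∈U (long-represented p≤h N S (+ toℕ i))
    ∣U∣≡0 : ∣ U ∣ˢ ≡ 0
    ∣U∣≡0 = ℕ.n≤0⇒n≡0 (injection⇒∣∣≤ U (λ i i∈U → contradiction i∈U (none i)) λ {i} i∈U → contradiction i∈U (none i))
  ... | no p≰h = begin
    ∣ U ∣ˢ ℕ.* (W ℕ.* W)                               ≤⟨ ℕ.*-mono-≤ (small-fractions-few A≤p U small) (ℕ.*-mono-≤ W≤K*32 W≤K*32) ⟩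
    -- The constants are 2 · 32² = 2048 and, from (A K)² ≤ 4 p², 4 · 2048 = 8192.
    2 ℕ.* (A ℕ.* A) ℕ.* (K ℕ.* 32 ℕ.* (K ℕ.* 32))      ≡⟨ regroup A K 2 32 ⟩
    A ℕ.* K ℕ.* (A ℕ.* K) ℕ.* 2048                     ≤⟨ ℕ.*-monoˡ-≤ 2048 (ℕ.*-mono-≤ AK≤2p AK≤2p) ⟩
    p ℕ.* 2 ℕ.* (p ℕ.* 2) ℕ.* 2048                     ≡⟨ cong (ℕ._* 2048) (ℕ.[m*n]*[o*p]≡[m*o]*[n*p] p 2 p 2) ⟩
    p ℕ.* p ℕ.* 4 ℕ.* 2048                             ≡⟨ ℕ.*-assoc (p ℕ.* p) 4 2048 ⟩
    p ℕ.* p ℕ.* 8192                                 ∎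
    where
    open Reduction p<AK A≤K
    open Box p<AK A≤K
    2+8K≤p = ℕ.≤-trans 2+8K≤h (ℕ.<⇒≤ (ℕ.≰⇒> p≰h))

    K≤p : K ≤ p
    K≤p = ℕ.≤-trans (ℕ.m≤n*m K 8) (ℕ.≤-trans (ℕ.m≤n+m (8 ℕ.* K) 2) 2+8K≤p)

    A≤p : A ≤ p
    A≤p = ℕ.≤-trans A≤K K≤p

    AK≤2p : A ℕ.* K ≤ p ℕ.* 2
    AK≤2p = subst (A ℕ.* K ≤_) (trans (cong (λ t → p ℕ.+ t) (sym (ℕ.+-identityʳ p))) (ℕ.*-comm 2 p))
      (ℕ.≤-trans AK≤p+K (ℕ.+-monoʳ-≤ p K≤p))

    small : ∀ i → i ∈ˢ U → SmallFraction A (+ toℕ i)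
    small i i∈U with reduced (ℕ.<⇒≤ (Fin.toℕ<n i))
    ... | inj₁ fraction = fraction
    ... | inj₂ R = contradiction (reduced-represented 2+8K≤h 2+8K≤p N S R) (missing i i∈U)

    regroup : ∀ A K a b → a ℕ.* (A ℕ.* A) ℕ.* (K ℕ.* b ℕ.* (K ℕ.* b)) ≡ A ℕ.* K ℕ.* (A ℕ.* K) ℕ.* (a ℕ.* (b ℕ.* b))
    regroup = ℕ.solve-∀

-- Choosing K and A from the length h.

module Missing {p : ℕ} (p-prime : Prime p) (h : ℕ) (p*4096≤W² : p ℕ.* 4096 ≤ (h ℕ.+ 3) ℕ.* (h ℕ.+ 3)) where
  open Residues p-prime
  open Lattice p
  open ℕ.≤-Reasoning

  W K A : ℕ
  W = h ℕ.+ 3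
  -- Dividing by 16 leaves room for two boxes of total height 2 + 8 K inside h, while K stays at
  -- least W / 32.
  K = W ℕ./ 16

  32≤W : 32 ≤ W
  32≤W = square-cancel-≤ (begin
    32 ℕ.* 32      ≤⟨ ℕ.*-monoˡ-≤ 32 {32} {128} (ℕ.m≤m+n 32 96) ⟩
    1 ℕ.* 4096     ≤⟨ ℕ.*-monoˡ-≤ 4096 (ℕ.<⇒≤ 1<p) ⟩
    p ℕ.* 4096     ≤⟨ p*4096≤W² ⟩
    W ℕ.* W        ∎)

  2≤K : 2 ≤ K
  2≤K = ℕ./-monoˡ-≤ 16 32≤W

  instance
    K≢0 : ℕ.NonZero K
    K≢0 = ℕ.>-nonZero (ℕ.≤-trans (s≤s z≤n) 2≤K)

  -- The least A with p < A K; minimality gives A K ≤ p + K.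
  A = suc (p ℕ./ K)

  W≤K*32 : W ≤ K ℕ.* 32
  W≤K*32 = begin
    W                                  ≡⟨ ℕ.m≡m%n+[m/n]*n W 16 ⟩
    W ℕ.% 16 ℕ.+ K ℕ.* 16              ≤⟨ ℕ.+-monoˡ-≤ (K ℕ.* 16) (ℕ.<⇒≤ (ℕ.m%n<n W 16)) ⟩
    16 ℕ.+ K ℕ.* 16                    ≤⟨ ℕ.+-monoˡ-≤ (K ℕ.* 16) (ℕ.*-monoˡ-≤ 16 (ℕ.<⇒≤ 2≤K)) ⟩
    K ℕ.* 16 ℕ.+ K ℕ.* 16              ≡⟨ ℕ.*-distribˡ-+ K 16 16 ⟨
    K ℕ.* 32                           ∎

  2+8K≤h : 2 ℕ.+ 8 ℕ.* K ≤ h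
  2+8K≤h = ℕ.+-cancelʳ-≤ 3 (2 ℕ.+ 8 ℕ.* K) h (begin
    2 ℕ.+ 8 ℕ.* K ℕ.+ 3                ≡⟨ ℕ.+-comm (2 ℕ.+ 8 ℕ.* K) 3 ⟩
    5 ℕ.+ 8 ℕ.* K                      ≤⟨ ℕ.+-monoˡ-≤ (8 ℕ.* K) (ℕ.≤-trans (ℕ.m≤m+n 5 11) (ℕ.*-monoʳ-≤ 8 2≤K)) ⟩
    8 ℕ.* K ℕ.+ 8 ℕ.* K                ≡⟨ double K ⟩
    K ℕ.* 16                           ≤⟨ ℕ.m/n*n≤m W 16 ⟩
    W                                  ∎)
    where
    double : ∀ K → 8 ℕ.* K ℕ.+ 8 ℕ.* K ≡ K ℕ.* 16
    double = ℕ.solve-∀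

  -- Dividing 4096 p ≤ W² by 32² leaves the factor 4; what matters is p < K², hence p / K < K and A
  -- ≤ K.
  p*4≤K² : p ℕ.* 4 ≤ K ℕ.* K
  p*4≤K² = ℕ.*-cancelʳ-≤ (p ℕ.* 4) (K ℕ.* K) 1024 (begin
    p ℕ.* 4 ℕ.* 1024                   ≡⟨ ℕ.*-assoc p 4 1024 ⟩
    p ℕ.* 4096                         ≤⟨ p*4096≤W² ⟩
    W ℕ.* W                            ≤⟨ ℕ.*-mono-≤ W≤K*32 W≤K*32 ⟩
    K ℕ.* 32 ℕ.* (K ℕ.* 32)            ≡⟨ ℕ.[m*n]*[o*p]≡[m*o]*[n*p] K 32 K 32 ⟩
    K ℕ.* K ℕ.* 1024                   ∎)

  A≤K : A ≤ K
  A≤K = ℕ.m<n*o⇒m/o<n (ℕ.<-≤-trans (ℕ.m<m*n p 4 (s≤s (s≤s z≤n))) p*4≤K²)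

  p<AK : p ℕ.< A ℕ.* K
  p<AK = begin-strict
    p                                  ≡⟨ ℕ.m≡m%n+[m/n]*n p K ⟩
    p ℕ.% K ℕ.+ p ℕ./ K ℕ.* K          <⟨ ℕ.+-monoˡ-< (p ℕ./ K ℕ.* K) (ℕ.m%n<n p K) ⟩
    K ℕ.+ p ℕ./ K ℕ.* K                ∎

  AK≤p+K : A ℕ.* K ≤ p ℕ.+ K
  AK≤p+K = subst (A ℕ.* K ≤_) (ℕ.+-comm K p) (ℕ.+-monoʳ-≤ K (ℕ.m/n*n≤m p K))

  open Count p-prime 2+8K≤h W≤K*32 p<AK A≤K AK≤p+K public using (missing-bound)

-- Integers inside the rationals, and floors.

module Embedding where
  open import Data.Rational.Base using (_+_; _*_)

  ι : ℤ → ℚ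
  ι i = i ℚ./ 1

  toℚᵘ-ι : ∀ i → ℚ.toℚᵘ (ι i) ℚᵘ.≃ mkℚᵘ i 0
  toℚᵘ-ι i = ℚ.toℚᵘ-fromℚᵘ (mkℚᵘ i 0)

  ι-+ : ∀ i j → ι (i ℤ.+ j) ≡ ι i + ι j
  ι-+ i j = ℚ.toℚᵘ-injective (begin
    ℚ.toℚᵘ (ι (i ℤ.+ j))                ≈⟨ toℚᵘ-ι (i ℤ.+ j) ⟩
    mkℚᵘ (i ℤ.+ j) 0                    ≈⟨ ℚᵘ.*≡* (expand i j) ⟩
    mkℚᵘ i 0 ℚᵘ.+ mkℚᵘ j 0              ≈⟨ ℚᵘ.+-cong (toℚᵘ-ι i) (toℚᵘ-ι j) ⟨
    ℚ.toℚᵘ (ι i) ℚᵘ.+ ℚ.toℚᵘ (ι j)      ≈⟨ ℚ.toℚᵘ-homo-+ (ι i) (ι j) ⟨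
    ℚ.toℚᵘ (ι i + ι j)                  ∎)
    where
    open import Relation.Binary.Reasoning.Setoid ℚᵘ.≃-setoid
    expand : ∀ i j → (i ℤ.+ j) ℤ.* + 1 ≡ (i ℤ.* + 1 ℤ.+ j ℤ.* + 1) ℤ.* + 1
    expand = ℤ.solve-∀

  ι-* : ∀ i j → ι (i ℤ.* j) ≡ ι i * ι j
  ι-* i j = ℚ.toℚᵘ-injective (begin
    ℚ.toℚᵘ (ι (i ℤ.* j))                ≈⟨ toℚᵘ-ι (i ℤ.* j) ⟩
    mkℚᵘ (i ℤ.* j) 0                    ≡⟨⟩
    mkℚᵘ i 0 ℚᵘ.* mkℚᵘ j 0              ≈⟨ ℚᵘ.*-cong (toℚᵘ-ι i) (toℚᵘ-ι j) ⟨
    ℚ.toℚᵘ (ι i) ℚᵘ.* ℚ.toℚᵘ (ι j)      ≈⟨ ℚ.toℚᵘ-homo-* (ι i) (ι j) ⟨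
    ℚ.toℚᵘ (ι i * ι j)                  ∎)
    where
    open import Relation.Binary.Reasoning.Setoid ℚᵘ.≃-setoid

  ι-mono-≤ : ∀ {i j} → i ℤ.≤ j → ι i ℚ.≤ ι j
  ι-mono-≤ {i} {j} i≤j = ℚ.toℚᵘ-cancel-≤ (begin
    ℚ.toℚᵘ (ι i)      ≃⟨ toℚᵘ-ι i ⟩
    mkℚᵘ i 0          ≤⟨ ℚᵘ.*≤* (ℤ.*-monoʳ-≤-nonNeg (+ 1) i≤j) ⟩
    mkℚᵘ j 0          ≃⟨ toℚᵘ-ι j ⟨
    ℚ.toℚᵘ (ι j)      ∎)
    where open ℚᵘ.≤-Reasoning

  ι-cancel-≤ : ∀ {i j} → ι i ℚ.≤ ι j → i ℤ.≤ j
  ι-cancel-≤ {i} {j} h = ℤ.*-cancelʳ-≤-pos i j (+ 1) (ℚᵘ.drop-*≤* (begin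
    mkℚᵘ i 0          ≃⟨ toℚᵘ-ι i ⟨
    ℚ.toℚᵘ (ι i)      ≤⟨ ℚ.toℚᵘ-mono-≤ h ⟩
    ℚ.toℚᵘ (ι j)      ≃⟨ toℚᵘ-ι j ⟩
    mkℚᵘ j 0          ∎))
    where open ℚᵘ.≤-Reasoning

  ιₙ : ℕ → ℚ
  ιₙ n = ι (+ n)

  ιₙ-+ : ∀ m n → ιₙ (m ℕ.+ n) ≡ ιₙ m + ιₙ n
  ιₙ-+ m n = trans (cong ι (ℤ.pos-+ m n)) (ι-+ (+ m) (+ n))

  ιₙ-* : ∀ m n → ιₙ (m ℕ.* n) ≡ ιₙ m * ιₙ n
  ιₙ-* m n = trans (cong ι (ℤ.pos-* m n)) (ι-* (+ m) (+ n))

  ιₙ-mono-≤ : ∀ {m n} → m ≤ n → ιₙ m ℚ.≤ ιₙ n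
  ιₙ-mono-≤ m≤n = ι-mono-≤ (ℤ.+≤+ m≤n)

  0≤ιₙ : ∀ n → 0ℚ ℚ.≤ ιₙ n
  0≤ιₙ n = ιₙ-mono-≤ {0} {n} z≤n

  0<ιₙ : ∀ {n} → 0 ℕ.< n → 0ℚ ℚ.< ιₙ n
  0<ιₙ {n} 0<n = ℚ.<-≤-trans (ℚ.positive⁻¹ 1ℚ) (ιₙ-mono-≤ {1} {n} 0<n)

  /-*-cancel : ∀ n k → (+ n ℚ./ suc k) * ιₙ (suc k) ≡ ιₙ n
  /-*-cancel n k = ℚ.toℚᵘ-injective (begin
    ℚ.toℚᵘ ((+ n ℚ./ suc k) * ιₙ (suc k))                 ≈⟨ ℚ.toℚᵘ-homo-* (+ n ℚ./ suc k) (ιₙ (suc k)) ⟩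
    ℚ.toℚᵘ (+ n ℚ./ suc k) ℚᵘ.* ℚ.toℚᵘ (ιₙ (suc k))       ≈⟨ ℚᵘ.*-cong (ℚ.toℚᵘ-fromℚᵘ (mkℚᵘ (+ n) k)) (toℚᵘ-ι (+ suc k)) ⟩
    mkℚᵘ (+ n) k ℚᵘ.* mkℚᵘ (+ suc k) 0                    ≈⟨ ℚᵘ.*≡* cross ⟩
    mkℚᵘ (+ n) 0                                          ≈⟨ toℚᵘ-ι (+ n) ⟨
    ℚ.toℚᵘ (ιₙ n)                                         ∎)
    where
    open import Relation.Binary.Reasoning.Setoid ℚᵘ.≃-setoid
    cross : + n ℤ.* + suc k ℤ.* + 1 ≡ + n ℤ.* + (suc k ℕ.* 1)
    cross = trans (ℤ.*-identityʳ (+ n ℤ.* + suc k)) (cong (λ t → + n ℤ.* + t) (sym (ℕ.*-identityʳ (suc k))))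

  ⌊⌋-bounds : ∀ q → 0ℚ ℚ.≤ q → ∃[ f ] ιₙ f ℚ.≤ q × q ℚ.≤ ιₙ (suc f)
  ⌊⌋-bounds q@(mkℚ (+ a) d _) _ = f , ℚ.toℚᵘ-cancel-≤ (begin
      ℚ.toℚᵘ (ιₙ f)         ≃⟨ toℚᵘ-ι (+ f) ⟩
      mkℚᵘ (+ f) 0          ≤⟨ ℚᵘ.*≤* (subst₂ ℤ._≤_ (ℤ.pos-* f (suc d)) (sym (ℤ.*-identityʳ (+ a))) (ℤ.+≤+ (ℕ.m/n*n≤m a (suc d)))) ⟩
      mkℚᵘ (+ a) d          ∎) ,
    ℚ.toℚᵘ-cancel-≤ (begin
      mkℚᵘ (+ a) d          ≤⟨ ℚᵘ.*≤* (subst₂ ℤ._≤_ (sym (ℤ.*-identityʳ (+ a))) (ℤ.pos-* (suc f) (suc d)) (ℤ.+≤+ a≤)) ⟩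
      mkℚᵘ (+ suc f) 0      ≃⟨ toℚᵘ-ι (+ suc f) ⟨
      ℚ.toℚᵘ (ιₙ (suc f))   ∎)
    where
    open ℚᵘ.≤-Reasoning
    f = a ℕ./ suc d
    a≤ : a ≤ suc f ℕ.* suc d
    a≤ = ℕ.≤-trans (ℕ.≤-reflexive (ℕ.m≡m%n+[m/n]*n a (suc d))) (ℕ.+-monoˡ-≤ (f ℕ.* suc d) (ℕ.<⇒≤ (ℕ.m%n<n a (suc d))))
  ⌊⌋-bounds (mkℚ -[1+ _ ] _ _) (ℚ.*≤* ())

open Embedding

-- Inequalities for the rational approximations.

module RationalBounds where
  open import Data.Rational.Base using (_+_; _*_; _-_; -_)
  open +-*-Solver

  √-seq-nonNeg : ∀ n k → 0ℚ ℚ.≤ √-seq n k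
  √-seq-nonNeg n k = ℚ.*-cancelʳ-≤-pos (ιₙ (suc k)) {{ℚ.positive (0<ιₙ {suc k} (s≤s z≤n))}}
    (subst₂ ℚ._≤_ (sym (ℚ.*-zeroˡ (ιₙ (suc k)))) (sym (/-*-cancel i k)) (0≤ιₙ i))
    where i = isqrt (n ℕ.* (suc k ℕ.* suc k))

  -- ⌊t⌋ ≥ t / 2 for every t ≥ 1.
  ≤4*√-seq² : ∀ n k → 0 ℕ.< n → ιₙ n ℚ.≤ √-seq n k * √-seq n k * ιₙ 4
  ≤4*√-seq² n k 0<n = ℚ.*-cancelʳ-≤-pos (K * K) {{ℚ.positive (0<* 0<K 0<K)}} (begin
      ιₙ n * (K * K)                   ≡⟨ trans (ιₙ-* n (suc k ℕ.* suc k)) (cong (ιₙ n *_) (ιₙ-* (suc k) (suc k))) ⟨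
      ιₙ (n ℕ.* (suc k ℕ.* suc k))     ≤⟨ ιₙ-mono-≤ {n ℕ.* (suc k ℕ.* suc k)} {i ℕ.* i ℕ.* 4} main ⟩
      ιₙ (i ℕ.* i ℕ.* 4)               ≡⟨ trans (ιₙ-* (i ℕ.* i) 4) (cong (_* ιₙ 4) (ιₙ-* i i)) ⟩
      ιₙ i * ιₙ i * ιₙ 4               ≡⟨ cong (λ t → t * t * ιₙ 4) (/-*-cancel i k) ⟨
      (s * K) * (s * K) * ιₙ 4         ≡⟨ solve 3 (λ s K c → (s :* K) :* (s :* K) :* c := s :* s :* c :* (K :* K)) refl s K (ιₙ 4) ⟩
      s * s * ιₙ 4 * (K * K)           ∎)
    where
    open ℚ.≤-Reasoning
    K = ιₙ (suc k)
    s = √-seq n k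
    i = isqrt (n ℕ.* (suc k ℕ.* suc k))
    0<K : 0ℚ ℚ.< K
    0<K = 0<ιₙ {suc k} (s≤s z≤n)

    main : n ℕ.* (suc k ℕ.* suc k) ≤ i ℕ.* i ℕ.* 4
    main with i | isqrt-< (n ℕ.* (suc k ℕ.* suc k))
    ... | zero  | n*<1 = contradiction (ℕ.*-mono-≤ 0<n (s≤s (z≤n {k ℕ.+ k ℕ.* suc k}))) (ℕ.<⇒≱ n*<1)
    ... | suc j | n*<  = ℕ.≤-trans (ℕ.<⇒≤ n*<) (subst ((2 ℕ.+ j) ℕ.* (2 ℕ.+ j) ≤_) (square j)
      (ℕ.*-mono-≤ (ℕ.+-monoʳ-≤ 2 (ℕ.m≤m+n j j)) (ℕ.+-monoʳ-≤ 2 (ℕ.m≤m+n j j))))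
      where
      square : ∀ j → (2 ℕ.+ (j ℕ.+ j)) ℕ.* (2 ℕ.+ (j ℕ.+ j)) ≡ suc j ℕ.* suc j ℕ.* 4
      square = ℕ.solve-∀

  -- The chain a x² P ≤ 4 a x² s² ≤ 4 a w² ≤ 4 c P², divided by P² x². It is applied to single
  -- terms: x approximates Δ, s approximates √p, w = h + 3, and a is the number of missing residues.
  error-bound : ∀ {a P w c x s} → 0ℚ ℚ.≤ a → 0ℚ ℚ.< P → 0ℚ ℚ.< x → 0ℚ ℚ.≤ s →
    P ℚ.≤ s * s * ιₙ 4 → x * s ℚ.≤ w → a * (w * w) ℚ.≤ P * P * c →
    a * recip P ℚ.≤ c * ιₙ 4 * (recip x * recip x)
  error-bound {a} {P} {w} {c} {x} {s} 0≤a 0<P 0<x 0≤s P≤4s² xs≤w aw²≤ = begin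
      a * recip P                                          ≡⟨ ℚ.*-identityʳ (a * recip P) ⟨
      a * recip P * (1ℚ * 1ℚ)                              ≡⟨ cong (λ t → a * recip P * (t * t)) (recip-inverseˡ 0<x) ⟨
      a * recip P * ((recip x * x) * (recip x * x))        ≡⟨ solve 4 (λ a R y x → a :* R :* ((y :* x) :* (y :* x)) := a :* (x :* x) :* (R :* (y :* y))) refl a (recip P) (recip x) x ⟩
      a * (x * x) * (recip P * (recip x * recip x))        ≤⟨ ℚ.*-monoʳ-≤-nonNeg (recip P * (recip x * recip x)) {{ℚ.nonNegative 0≤R}} ax²≤ ⟩
      P * (c * ιₙ 4) * (recip P * (recip x * recip x))     ≡⟨ solve 4 (λ P d R y → P :* d :* (R :* y) := (R :* P) :* (d :* y)) refl P (c * ιₙ 4) (recip P) (recip x * recip x) ⟩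
      (recip P * P) * (c * ιₙ 4 * (recip x * recip x))     ≡⟨ cong (_* (c * ιₙ 4 * (recip x * recip x))) (recip-inverseˡ 0<P) ⟩
      1ℚ * (c * ιₙ 4 * (recip x * recip x))                ≡⟨ ℚ.*-identityˡ _ ⟩
      c * ιₙ 4 * (recip x * recip x)                       ∎
    where
    open ℚ.≤-Reasoning
    0≤4 = 0≤ιₙ 4
    0≤R : 0ℚ ℚ.≤ recip P * (recip x * recip x)
    0≤R = 0≤* (0≤recip 0<P) (0≤* (0≤recip 0<x) (0≤recip 0<x))
    0≤x = ℚ.<⇒≤ 0<x
    0≤xs = 0≤* 0≤x 0≤s
    0≤ax² = 0≤* 0≤a (0≤* 0≤x 0≤x)
    ax²≤ : a * (x * x) ℚ.≤ P * (c * ιₙ 4)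
    ax²≤ = ℚ.*-cancelʳ-≤-pos P {{ℚ.positive 0<P}} (begin
      a * (x * x) * P                     ≤⟨ ℚ.*-monoˡ-≤-nonNeg (a * (x * x)) {{ℚ.nonNegative 0≤ax²}} P≤4s² ⟩
      a * (x * x) * (s * s * ιₙ 4)        ≡⟨ solve 4 (λ a x s f → a :* (x :* x) :* (s :* s :* f) := a :* ((x :* s) :* (x :* s)) :* f) refl a x s (ιₙ 4) ⟩
      a * ((x * s) * (x * s)) * ιₙ 4      ≤⟨ ℚ.*-monoʳ-≤-nonNeg (ιₙ 4) {{ℚ.nonNegative 0≤4}} (ℚ.*-monoˡ-≤-nonNeg a {{ℚ.nonNegative 0≤a}} (*-mono-≤ 0≤xs (ℚ.≤-trans 0≤xs xs≤w) xs≤w xs≤w)) ⟩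
      a * (w * w) * ιₙ 4                  ≤⟨ ℚ.*-monoʳ-≤-nonNeg (ιₙ 4) {{ℚ.nonNegative 0≤4}} aw²≤ ⟩
      P * P * c * ιₙ 4                    ≡⟨ solve 3 (λ P c f → P :* P :* c :* f := P :* (c :* f) :* P) refl P c (ιₙ 4) ⟩
      P * (c * ιₙ 4) * P                  ∎)

  -- Turns a lower bound d for Δ into a purely integral inequality: n d² ≤ 4 s² x² ≤ 4 w².
  scaled-bound : ∀ n d w {x s} → ιₙ d ℚ.≤ x → 0ℚ ℚ.≤ s → ιₙ n ℚ.≤ s * s * ιₙ 4 → x * s ℚ.≤ ιₙ w →
    n ℕ.* (d ℕ.* d) ≤ w ℕ.* w ℕ.* 4
  scaled-bound n d w {x} {s} d≤x 0≤s n≤4s² xs≤w = ℤ.drop‿+≤+ (ι-cancel-≤ {+ (n ℕ.* (d ℕ.* d))} {+ (w ℕ.* w ℕ.* 4)} (begin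
    ιₙ (n ℕ.* (d ℕ.* d))            ≡⟨ trans (ιₙ-* n (d ℕ.* d)) (cong (ιₙ n *_) (ιₙ-* d d)) ⟩
    ιₙ n * (ιₙ d * ιₙ d)            ≤⟨ *-mono-≤ (0≤ιₙ n) (0≤* 0≤x 0≤x) n≤4s² (*-mono-≤ (0≤ιₙ d) 0≤x d≤x d≤x) ⟩
    s * s * ιₙ 4 * (x * x)          ≡⟨ solve 3 (λ x s f → s :* s :* f :* (x :* x) := (x :* s) :* (x :* s) :* f) refl x s (ιₙ 4) ⟩
    (x * s) * (x * s) * ιₙ 4        ≤⟨ ℚ.*-monoʳ-≤-nonNeg (ιₙ 4) {{ℚ.nonNegative (0≤ιₙ 4)}} (*-mono-≤ 0≤xs (ℚ.≤-trans 0≤xs xs≤w) xs≤w xs≤w) ⟩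
    ιₙ w * ιₙ w * ιₙ 4              ≡⟨ trans (ιₙ-* (w ℕ.* w) 4) (cong (_* ιₙ 4) (ιₙ-* w w)) ⟨
    ιₙ (w ℕ.* w ℕ.* 4)              ∎))
    where
    open ℚ.≤-Reasoning
    0≤x = ℚ.≤-trans (0≤ιₙ d) d≤x
    0≤xs = 0≤* 0≤x 0≤s

open RationalBounds

∣p-q∣≤1⇒p≤q+1 : ∀ {a b} → ℚ.∣ a ℚ.- b ∣ ℚ.≤ 1ℚ → a ℚ.≤ b ℚ.+ 1ℚ
∣p-q∣≤1⇒p≤q+1 {a} {b} ∣a-b∣≤1 = subst (ℚ._≤ b ℚ.+ 1ℚ) (solve 2 (λ a b → b :+ (a :- b) := a) refl a b)
  (ℚ.+-monoʳ-≤ b (ℚ.≤-trans (p≤∣p∣ (a ℚ.- b)) ∣a-b∣≤1))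
  where
  open +-*-Solver
  p≤∣p∣ : ∀ p → p ℚ.≤ ℚ.∣ p ∣
  p≤∣p∣ p with ℚ.≤-total 0ℚ p
  ... | inj₁ 0≤p = ℚ.≤-reflexive (sym (ℚ.0≤p⇒∣p∣≡p 0≤p))
  ... | inj₂ p≤0 = ℚ.≤-trans p≤0 (ℚ.0≤∣p∣ p)

-- From the real length Δ √p to an integer h, and the final error term.

module LargeMultiple {p : ℕ} (p-prime : Prime p) (δ : ℝ) (129≤δ : fromℕ 129 ≤ℝ δ) where
  open import Data.Rational.Base using (_+_; _*_; _-_; -_)
  open +-*-Solver
  open Residues p-prime

  0<p : 0 ℕ.< p
  0<p = ℕ.<⇒≤ 1<p

  positive : ∀ f → p ℕ.* 4096 ≤ (f ℕ.+ 2) ℕ.* (f ℕ.+ 2) → ∃[ h ] f ≡ suc h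
  positive (suc h) _      = h , refl
  positive zero p*4096≤4 = contradiction (ℕ.≤-trans (ℕ.*-monoˡ-≤ 4096 0<p) p*4096≤4) (ℕ.<⇒≱ {4} {4096} (ℕ.m≤m+n 5 4091))

  H : ℝ
  H = δ *ℝ √ p

  M₁ = proj₁ (129≤δ 1ℚ (ℚ.positive⁻¹ 1ℚ))
  M₂ = proj₁ (cauchy H 1ℚ (ℚ.positive⁻¹ 1ℚ))

  -- With ε = 1 the inequality 129 ≤ Δ loses 1 on the terms, and 128 remains.
  128≤ : ∀ n → M₁ ≤ n → ιₙ 128 ℚ.≤ seq δ n
  128≤ n M₁≤n = subst₂ ℚ._≤_ (cancel (ιₙ 128)) (cancel (seq δ n))
    (ℚ.+-monoˡ-≤ (- 1ℚ) (subst (ℚ._≤ seq δ n + 1ℚ) (ιₙ-+ 128 1) (proj₂ (129≤δ 1ℚ (ℚ.positive⁻¹ 1ℚ)) n M₁≤n)))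
    where
    cancel : ∀ a → a + 1ℚ - 1ℚ ≡ a
    cancel a = solve 2 (λ a u → a :+ u :- u := a) refl a 1ℚ

  δ>0 : 0ℝ <ℝ δ
  δ>0 = 1ℚ , ℚ.positive⁻¹ 1ℚ , M₁ , λ n M₁≤n →
    ℚ.≤-trans (ιₙ-mono-≤ {1} {128} (s≤s z≤n)) (128≤ n M₁≤n)

  0<δₙ : ∀ n → M₁ ≤ n → 0ℚ ℚ.< seq δ n
  0<δₙ n M₁≤n = ℚ.<-≤-trans (0<ιₙ {128} (s≤s z≤n)) (128≤ n M₁≤n)

  -- From this index on, the terms of Δ are at least 128 and those of `H` vary by at most 1, so the
  -- floor f of the single term `seq H M` controls all later terms.
  M = M₁ ℕ.⊔ M₂

  0≤H : 0ℚ ℚ.≤ seq H M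
  0≤H = 0≤* (ℚ.<⇒≤ (0<δₙ M (ℕ.m≤m⊔n M₁ M₂))) (√-seq-nonNeg p M)

  approximation : ∃[ f ] ιₙ f ℚ.≤ seq H M × seq H M ℚ.≤ ιₙ (suc f)
  approximation = ⌊⌋-bounds (seq H M) 0≤H

  f = proj₁ approximation

  near : ∀ n → M ≤ n → (seq H M ℚ.≤ seq H n + 1ℚ) × (seq H n ℚ.≤ seq H M + 1ℚ)
  near n M≤n = ∣p-q∣≤1⇒p≤q+1 (c M n M₂≤M (ℕ.≤-trans M₂≤M M≤n)) , ∣p-q∣≤1⇒p≤q+1 (c n M (ℕ.≤-trans M₂≤M M≤n) M₂≤M)
    where
    c = proj₂ (cauchy H 1ℚ (ℚ.positive⁻¹ 1ℚ))
    M₂≤M = ℕ.m≤n⊔m M₁ M₂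

  H≤f+2 : ∀ n → M ≤ n → seq δ n * √-seq p n ℚ.≤ ιₙ (f ℕ.+ 2)
  H≤f+2 n M≤n = begin
    seq H n             ≤⟨ proj₂ (near n M≤n) ⟩
    seq H M + 1ℚ        ≤⟨ ℚ.+-monoˡ-≤ 1ℚ (proj₂ (proj₂ approximation)) ⟩
    ιₙ (suc f) + 1ℚ     ≡⟨ ιₙ-+ (suc f) 1 ⟨
    ιₙ (suc f ℕ.+ 1)    ≡⟨ cong ιₙ (ℕ.+-suc f 1) ⟨
    ιₙ (f ℕ.+ 2)        ∎
    where open ℚ.≤-Reasoning

  p*4096≤[f+2]² : p ℕ.* 4096 ≤ (f ℕ.+ 2) ℕ.* (f ℕ.+ 2)
  p*4096≤[f+2]² = ℕ.*-cancelʳ-≤ (p ℕ.* 4096) ((f ℕ.+ 2) ℕ.* (f ℕ.+ 2)) 4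
    (subst (_≤ (f ℕ.+ 2) ℕ.* (f ℕ.+ 2) ℕ.* 4) (sym (ℕ.*-assoc p 4096 4))
      (scaled-bound p 128 (f ℕ.+ 2) (128≤ M (ℕ.m≤m⊔n M₁ M₂)) (√-seq-nonNeg p M) (≤4*√-seq² p M 0<p) (H≤f+2 M ℕ.≤-refl)))

  f-positive : ∃[ h ] f ≡ suc h
  f-positive = positive f p*4096≤[f+2]²

  -- One below the floor f: the terms may drop by 1 after index `M`, and h ≤ `seq H n` has to
  -- survive. In the other direction, f + 1 plus the variation 1 gives h + 3.
  h = proj₁ f-positive

  f+2≡h+3 : f ℕ.+ 2 ≡ h ℕ.+ 3
  f+2≡h+3 = trans (cong (ℕ._+ 2) (proj₂ f-positive)) (sym (ℕ.+-suc h 2))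

  h≤H : ∀ n → M ≤ n → ιₙ h ℚ.≤ seq H n
  h≤H n M≤n = subst₂ ℚ._≤_ (cancel (ιₙ h)) (cancel (seq H n)) (ℚ.+-monoˡ-≤ (- 1ℚ) (begin
    ιₙ h + 1ℚ           ≡⟨ ιₙ-+ h 1 ⟨
    ιₙ (h ℕ.+ 1)        ≡⟨ cong ιₙ (trans (ℕ.+-comm h 1) (sym (proj₂ f-positive))) ⟩
    ιₙ f                ≤⟨ proj₁ (proj₂ approximation) ⟩
    seq H M             ≤⟨ proj₁ (near n M≤n) ⟩
    seq H n + 1ℚ        ∎))
    where
    open ℚ.≤-Reasoning
    cancel : ∀ a → a + 1ℚ - 1ℚ ≡ a
    cancel a = solve 2 (λ a u → a :+ u :- u := a) refl a 1ℚ

  below : ∀ N x → x ℤ.≤ N ℤ.+ + h → fromℤ x ≤ℝ fromℤ N +ℝ H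
  below N x x≤N+h ε 0<ε = M , λ n M≤n → begin
    ι x                       ≤⟨ ι-mono-≤ x≤N+h ⟩
    ι (N ℤ.+ + h)             ≡⟨ ι-+ N (+ h) ⟩
    ι N + ιₙ h                ≤⟨ ℚ.+-monoʳ-≤ (ι N) (h≤H n M≤n) ⟩
    ι N + seq H n             ≡⟨ ℚ.+-identityʳ (ι N + seq H n) ⟨
    ι N + seq H n + 0ℚ        ≤⟨ ℚ.+-monoʳ-≤ (ι N + seq H n) (ℚ.<⇒≤ 0<ε) ⟩
    ι N + seq H n + ε         ∎
    where open ℚ.≤-Reasoning

  open Missing p-prime h (subst (λ w → p ℕ.* 4096 ≤ w ℕ.* w) f+2≡h+3 p*4096≤[f+2]²) using (missing-bound)

  -- The residues outside `T` are not quotients, hence not represented in the box of side h, so the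
  -- bound on missing residues applies to the complement.
  cardinality : ∀ N S c → HasCardinality (Quotients p N S H) c →
    ∃[ m ] (m ℕ.+ c ≡ p) × (m ℕ.* ((h ℕ.+ 3) ℕ.* (h ℕ.+ 3)) ≤ p ℕ.* p ℕ.* 8192)
  cardinality N S c (T , T⇔ , ∣T∣≡c) = ∣ ∁ T ∣ˢ ,
    trans (cong₂ ℕ._+_ (trans (Subset.∣∁p∣≡n∸∣p∣ T) (cong (p ℕ.∸_) ∣T∣≡c)) refl)
      (ℕ.m∸n+n≡m (subst (_≤ p) ∣T∣≡c (Subset.∣p∣≤n T))) ,
    missing-bound N S (∁ T) λ i i∈∁T represented →
      Subset.x∈∁p⇒x∉p i∈∁T (Equivalence.from (T⇔ i) (represented⇒quotient {N} {S} {h} {H} below {i} represented))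

  conclusion : ∀ m c → m ℕ.+ c ≡ p → m ℕ.* ((h ℕ.+ 3) ℕ.* (h ℕ.+ 3)) ≤ p ℕ.* p ℕ.* 8192 →
    ∃[ E ] (fromℕ c ≃ℝ (1ℝ +ℝ E) *ℝ fromℕ p) × (∣ E ∣ℝ ≤ℝ fromℚ (ιₙ 8192 * ιₙ 4) *ℝ (inverse δ δ>0 *ℝ inverse δ δ>0))
  -- The relative error is exactly - m / p, a rational number, so c = (1 + E) p holds term by term.
  conclusion m c m+c≡p mW²≤ = fromℚ (- e) , c≃ , small
    where
    P = ιₙ p
    e = ιₙ m * recip P
    0<P : 0ℚ ℚ.< P
    0<P = 0<ιₙ {p} 0<p

    exact : ιₙ c ≡ (1ℚ - e) * P
    exact = begin
      ιₙ c                             ≡⟨ solve 2 (λ m c → c := m :+ c :- m) refl (ιₙ m) (ιₙ c) ⟩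
      ιₙ m + ιₙ c - ιₙ m               ≡⟨ cong (_- ιₙ m) (ιₙ-+ m c) ⟨
      ιₙ (m ℕ.+ c) - ιₙ m              ≡⟨ cong (λ t → ιₙ t - ιₙ m) m+c≡p ⟩
      P - ιₙ m                         ≡⟨ cong (λ t → P - t) (ℚ.*-identityʳ (ιₙ m)) ⟨
      P - ιₙ m * 1ℚ                    ≡⟨ cong (λ t → P - ιₙ m * t) (recip-inverseˡ 0<P) ⟨
      P - ιₙ m * (recip P * P)         ≡⟨ cong (_- ιₙ m * (recip P * P)) (ℚ.*-identityˡ P) ⟨
      1ℚ * P - ιₙ m * (recip P * P)    ≡⟨ solve 4 (λ u P m R → u :* P :- m :* (R :* P) := (u :- m :* R) :* P) refl 1ℚ P (ιₙ m) (recip P) ⟩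
      (1ℚ - e) * P                     ∎
      where open ≡-Reasoning

    c≃ : fromℕ c ≃ℝ (1ℝ +ℝ fromℚ (- e)) *ℝ fromℕ p
    c≃ ε 0<ε = 0 , λ _ _ → subst (λ t → ℚ.∣ t ∣ ℚ.≤ ε)
      (sym (trans (cong (_- (1ℚ - e) * P) exact) (ℚ.+-inverseʳ ((1ℚ - e) * P)))) (ℚ.<⇒≤ 0<ε)

    mW²≤′ : ιₙ m * (ιₙ (h ℕ.+ 3) * ιₙ (h ℕ.+ 3)) ℚ.≤ P * P * ιₙ 8192
    mW²≤′ = subst₂ ℚ._≤_
      (trans (ιₙ-* m (W ℕ.* W)) (cong (ιₙ m *_) (ιₙ-* W W)))
      (trans (ιₙ-* (p ℕ.* p) 8192) (cong (_* ιₙ 8192) (ιₙ-* p p)))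
      (ιₙ-mono-≤ {m ℕ.* (W ℕ.* W)} {p ℕ.* p ℕ.* 8192} mW²≤)
      where W = h ℕ.+ 3

    -- The n-th term of C Δ⁻², because `inverse` and `_*ℝ_` act termwise.
    bound : ℕ → ℚ
    bound n = ιₙ 8192 * ιₙ 4 * (recip (seq δ n) * recip (seq δ n))

    small : ∣ fromℚ (- e) ∣ℝ ≤ℝ fromℚ (ιₙ 8192 * ιₙ 4) *ℝ (inverse δ δ>0 *ℝ inverse δ δ>0)
    small ε 0<ε = M , λ n M≤n →
      let M₁≤n = ℕ.≤-trans (ℕ.m≤m⊔n M₁ M₂) M≤n in begin
      ℚ.∣ - e ∣                                                      ≡⟨ ℚ.∣-p∣≡∣p∣ e ⟩
      ℚ.∣ e ∣                                                        ≡⟨ ℚ.0≤p⇒∣p∣≡p (0≤* (0≤ιₙ m) (0≤recip 0<P)) ⟩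
      e                                                              ≤⟨ error-bound {ιₙ m} {P} {ιₙ (h ℕ.+ 3)} {ιₙ 8192} {seq δ n} {√-seq p n} (0≤ιₙ m) 0<P (0<δₙ n M₁≤n) (√-seq-nonNeg p n) (≤4*√-seq² p n 0<p)
                                                                          (subst (λ w → seq δ n * √-seq p n ℚ.≤ ιₙ w) f+2≡h+3 (H≤f+2 n M≤n)) mW²≤′ ⟩
      bound n           ≡⟨ ℚ.+-identityʳ (bound n) ⟨
      bound n + 0ℚ      ≤⟨ ℚ.+-monoʳ-≤ (bound n) (ℚ.<⇒≤ 0<ε) ⟩
      bound n + ε       ∎
      where open ℚ.≤-Reasoning

theorem8 : (Δ : ℕ → ℝ) → TendsToInfinityOnPrimes Δ →
    ∃[ C ] ∃[ P ] ∀ p → Prime p → P ≤ p →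
    Σ[ Δ>0 ∈ 0ℝ <ℝ Δ p ] let Δ⁻¹ = inverse (Δ p) Δ>0 in
    ∀ (N S : ℤ) (c : ℕ) → HasCardinality (Quotients p N S (Δ p *ℝ √ p)) c →
    ∃[ E ] (fromℕ c ≃ℝ (1ℝ +ℝ E) *ℝ fromℕ p) × (∣ E ∣ℝ ≤ℝ C *ℝ (Δ⁻¹ *ℝ Δ⁻¹))
theorem8 Δ Δ→∞ =
  -- The choice 128 = 129 - 1 gives 128² p ≤ 4 (h + 3)², that is 4096 p ≤ (h + 3)². In C = 8192 · 4,
  -- the factor 4 is the loss in p ≤ 4 s² for the floored square root s.
  let P , 129≤Δ = Δ→∞ (fromℕ 129) in
  fromℚ (ιₙ 8192 ℚ.* ιₙ 4) , P , λ p p-prime P≤p →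
  let open LargeMultiple p-prime (Δ p) (129≤Δ p p-prime P≤p) in
  δ>0 , λ N S c card →
  let m , m+c≡p , mW²≤ = cardinality N S c card in conclusion m c m+c≡p mW²≤
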